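{- Let $d\ge 1$. Let $\mathcal{P}_N$ (resp. $\mathcal{P}_S$) be the problem of deciding whether two given stochastic cellular automata of dimension $d$ have the same non-deterministic (resp. stochastic) global function, i.e. whether $\mathcal{N}_F=\mathcal{N}_G$ (resp. $\mathcal{S}_F=\mathcal{S}_G$), where $F$ and $G$ are their explicit global functions. Then the surjectivity problem of classical deterministic cellular automata of dimension $d$ (given a classical cellular automaton, is its global map $Q^{\mathbb{Z}^d}\to Q^{\mathbb{Z}^d}$ surjective?) is (computably) reducible to both $\mathcal{P}_N$ and $\mathcal{P}_S$.
   Context: A stochastic cellular automaton (stochastic CA) of dimension $d$ is a tuple $\mathcal{A}=(Q,R,V,V',f)$ where $Q$ (states) and $R$ (random symbols) are finite sets, $V=\{v_1,\dots,v_\rho\}$ and $V'=\{v'_1,\dots,v'_{\rho'}\}$ are finite subsets of $\mathbb{Z}^d$, and $f:Q^\rho\times R^{\rho'}\to Q$ is the local function. Its explicit global function $F:Q^{\mathbb{Z}^d}\times R^{\mathbb{Z}^d}\to Q^{\mathbb{Z}^d}$ is $F(c,s)_z=f\big((c_{z+v_1},\dots,c_{z+v_\rho}),(s_{z+v'_1},\dots,s_{z+v'_{\rho'}})\big)$. Its non-deterministic global function maps a configuration $c\in Q^{\mathbb{Z}^d}$ to the set $\mathcal{N}_F(c)=\{F(c,s):s\in R^{\mathbb{Z}^d}\}$. Its stochastic global function maps $c$ to the Borel probability measure $\mathcal{S}_F(c)$ on $Q^{\mathbb{Z}^d}$ that is the law of $F(c,s)$ when $s$ is drawn from the uniform (i.i.d.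 uniform product) measure $\nu_R$ on $R^{\mathbb{Z}^d}$, i.e. $\mathcal{S}_F(c)(E)=\nu_R(\{s:F(c,s)\in E\})$. Two stochastic CA may have different sets of random symbols and neighborhoods. CA are given as inputs by their finite description $(Q,R,V,V',f)$. -}

module Defs where

open import Data.Fin using (Fin; toℕ)
open import Data.Integer as ℤ using (ℤ; +_; -[1+_])
open import Data.List as List using (List; []; _∷_)
open import Data.Maybe using (Maybe; just; nothing)
open import Data.Nat using (ℕ; zero; suc; NonZero; _^_)
open import Data.Nat.Properties using (m^n≢0)
open import Data.Product using (Σ; Σ-syntax; ∃-syntax; _×_; _,_)
open import Data.Rational as ℚ using (ℚ; 0ℚ)
open import Data.Vec as Vec using (Vec; []; _∷_; lookup; _[_]≔_)
open import Data.Vec.Relation.Unary.Unique.Propositional using (Unique)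
open import Function.Bundles using (_⇔_)
open import Function.Definitions using (Surjective)
open import Level using (0ℓ)
open import Relation.Binary.PropositionalEquality using (_≡_; _≢_; subst; _≗_)
open import Relation.Unary using (Pred; _∈_; _≐_; ∁; ⋃)

-- Alphabets are Fin n, with n = 0 allowed.  Configurations are functions, compared
-- pointwise (_≗_) since function extensionality is not available.

Site : ℕ → Set
Site d = Vec ℤ d

_⊹_ : ∀ {d} → Site d → Site d → Site d
_⊹_ = Vec.zipWith ℤ._+_

Config : ℕ → ℕ → Set
Config d n = Site d → Fin n

around : ∀ {d n k} → Config d n → Site d → Vec (Site d) k → Vec (Fin n) k
around c z V = Vec.map (λ v → c (z ⊹ v)) V

record ClassicalCA (d : ℕ) : Set where
  field
    #Q       : ℕ
    {ρ}      : ℕ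
    V        : Vec (Site d) ρ
    V-unique : Unique V
    f        : Vec (Fin #Q) ρ → Fin #Q

  global : Config d #Q → Config d #Q
  global c z = f (around c z V)

-- R is nonempty, as there is no probability measure on an empty R^(ℤ^d).
record StochasticCA (d #Q : ℕ) : Set where
  field
    #R            : ℕ
    ⦃ #R-nonZero ⦄ : NonZero #R
    {ρ ρ′}        : ℕ
    V             : Vec (Site d) ρ
    V-unique      : Unique V
    V′            : Vec (Site d) ρ′
    V′-unique     : Unique V′
    f             : Vec (Fin #Q) ρ → Vec (Fin #R) ρ′ → Fin #Q

  explicit : Config d #Q → Config d #R → Config d #Q
  explicit c s z = f (around c z V) (around s z V′)

nonDet : ∀ {d q} → StochasticCA d q → Config d q → Pred (Config d q) 0ℓ
nonDet A c e = ∃[ s ] explicit c s ≗ e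
  where open StochasticCA A

record Cylinder (d n : ℕ) : Set where
  field
    {size}   : ℕ
    sites    : Vec (Site d) size
    distinct : Unique sites
    symbols  : Vec (Fin n) size

⟦_⟧ᶜ : ∀ {d n} → Cylinder d n → Pred (Config d n) 0ℓ
⟦ u ⟧ᶜ c = Vec.map c (Cylinder.sites u) ≡ Cylinder.symbols u

-- Codes for the σ-algebra generated by the cylinders.  The product
-- topology has the (countably many) cylinders as a base, so this is the
-- Borel σ-algebra.
data Borel (d n : ℕ) : Set where
  cyl        : Cylinder d n → Borel d n
  complement : Borel d n → Borel d n
  union      : (ℕ → Borel d n) → Borel d n

⟦_⟧ : ∀ {d n} → Borel d n → Pred (Config d n) 0ℓ
⟦ cyl u ⟧        = ⟦ u ⟧ᶜ
⟦ complement E ⟧ = ∁ ⟦ E ⟧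
⟦ union E ⟧      = ⋃ ℕ (λ i → ⟦ E i ⟧)

module _ {d n : ℕ} where

  -- A sequence of cylinders, some of which may be missing.
  Cover : Set
  Cover = ℕ → Maybe (Cylinder d n)

  _covers_ : Cover → Pred (Config d n) 0ℓ → Set
  U covers E = ∀ {c} → c ∈ E → ∃[ i ] ∃[ u ] (U i ≡ just u × c ∈ ⟦ u ⟧ᶜ)

module _ {d n : ℕ} ⦃ _ : NonZero n ⦄ where

  weight : Maybe (Cylinder d n) → ℚ
  weight nothing  = 0ℚ
  weight (just u) = ℚ._/_ (+ 1) (n ^ k) ⦃ m^n≢0 n k ⦄
    where k = Cylinder.size u

  partialSum : Cover {d} {n} → ℕ → ℚ
  partialSum U zero    = 0ℚ
  partialSum U (suc m) = partialSum U m ℚ.+ weight (U m)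

-- A real number, given by its upper cut: the set of rationals above it.
UpperReal : Set₁
UpperReal = Pred ℚ 0ℓ

-- The i.i.d. uniform measure, by Carathéodory's construction: on Borel
-- sets it is the outer measure
--   ν E = inf { Σᵢ weight (U i) | U a countable cover of E by cylinders },
-- so ν E < x iff some cover has total weight at most some y < x.
uniform : ∀ d n ⦃ _ : NonZero n ⦄ → Pred (Config d n) 0ℓ → UpperReal
uniform d n E x =
  Σ[ U ∈ Cover {d} {n} ] U covers E ×
  (∃[ y ] (y ℚ.< x × (∀ m → partialSum U m ℚ.≤ y)))

stochastic : ∀ {d q} → StochasticCA d q → Config d q → Borel d q → UpperReal
stochastic {d} A c E = uniform d #R (λ s → explicit c s ∈ ⟦ E ⟧)
  where open StochasticCA A

-- The model of computation is Jones's (Turing-complete) WHILE language,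
-- whose data are binary trees.

infixr 5 _·_

data Tree : Set where
  nil : Tree
  _·_ : Tree → Tree → Tree

head tail : Tree → Tree
head nil     = nil
head (s · t) = s
tail nil     = nil
tail (s · t) = t

data Exp (k : ℕ) : Set where
  var   : Fin k → Exp k
  nil   : Exp k
  cons  : Exp k → Exp k → Exp k
  hd tl : Exp k → Exp k

infix  4 _≔_
infixr 3 _⨾_

data Cmd (k : ℕ) : Set where
  _≔_      : Fin k → Exp k → Cmd k
  _⨾_      : Cmd k → Cmd k → Cmd k
  while_body_ : Exp k → Cmd k → Cmd k

Store : ℕ → Set
Store k = Vec Tree k

eval : ∀ {k} → Exp k → Store k → Tree
eval (var i)    σ = lookup σ i
eval nil        σ = nil
eval (cons a b) σ = eval a σ · eval b σ
eval (hd a)     σ = head (eval a σ)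
eval (tl a)     σ = tail (eval a σ)

infix 2 ⟨_,_⟩⇓_

data ⟨_,_⟩⇓_ {k : ℕ} : Cmd k → Store k → Store k → Set where
  assign : ∀ {i a σ} → ⟨ i ≔ a , σ ⟩⇓ σ [ i ]≔ eval a σ
  seq    : ∀ {p p′ σ σ′ σ″} →
           ⟨ p , σ ⟩⇓ σ′ → ⟨ p′ , σ′ ⟩⇓ σ″ → ⟨ p ⨾ p′ , σ ⟩⇓ σ″
  stop   : ∀ {a p σ} → eval a σ ≡ nil → ⟨ while a body p , σ ⟩⇓ σ
  loop   : ∀ {a p σ σ′ σ″} → eval a σ ≢ nil →
           ⟨ p , σ ⟩⇓ σ′ → ⟨ while a body p , σ′ ⟩⇓ σ″ →
           ⟨ while a body p , σ ⟩⇓ σ″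

-- Variable zero holds the input and the output; the others start as nil.
record Program : Set where
  field
    {extra} : ℕ
    code    : Cmd (suc extra)

_maps_to_ : Program → Tree → Tree → Set
P maps s to t =
  ∃[ σ ] (⟨ Program.code P , s ∷ Vec.replicate _ nil ⟩⇓ t ∷ σ)

record Problem : Set₁ where
  field
    Instance : Set
    encode   : Instance → Tree
    Yes      : Instance → Set

Computable : (P P′ : Problem) →
             (Problem.Instance P → Problem.Instance P′) → Set
Computable P P′ r =
  Σ[ prog ∈ Program ]
    (∀ x → prog maps Problem.encode P x to Problem.encode P′ (r x))

infix 4 _≤ₘ_

_≤ₘ_ : Problem → Problem → Set
P ≤ₘ P′ =
  Σ[ r ∈ (Problem.Instance P → Problem.Instance P′) ]
    Computable P P′ r × (∀ x → Problem.Yes P x ⇔ Problem.Yes P′ (r x))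

encℕ : ℕ → Tree
encℕ zero    = nil
encℕ (suc n) = nil · encℕ n

encFin : ∀ {n} → Fin n → Tree
encFin i = encℕ (toℕ i)

encℤ : ℤ → Tree
encℤ (+ n)    = nil · encℕ n
encℤ -[1+ n ] = (nil · nil) · encℕ n

encList : ∀ {A : Set} → (A → Tree) → List A → Tree
encList enc []       = nil
encList enc (x ∷ xs) = enc x · encList enc xs

encVec : ∀ {A : Set} {k} → (A → Tree) → Vec A k → Tree
encVec enc xs = encList enc (Vec.toList xs)

encNbhd : ∀ {d k} → Vec (Site d) k → Tree
encNbhd = encVec (encVec encℤ)

-- All vectors, in lexicographic order; a local function is described by
-- the list of its values in this order.
allVecs : ∀ n k → List (Vec (Fin n) k)
allVecs n zero    = [] ∷ []
allVecs n (suc k) = List.cartesianProductWith _∷_ (List.allFin n) (allVecs n k)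

encClassical : ∀ {d} → ClassicalCA d → Tree
encClassical A = encℕ #Q · encNbhd V · encList encFin (List.map f (allVecs #Q ρ))
  where open ClassicalCA A

encStochastic : ∀ {d} → Σ ℕ (StochasticCA d) → Tree
encStochastic (#Q , A) =
  encℕ #Q · encℕ #R · encNbhd V · encNbhd V′ ·
  encList encFin (List.cartesianProductWith f (allVecs #Q ρ) (allVecs #R ρ′))
  where open StochasticCA A

surjectivity : ℕ → Problem
surjectivity d = record
  { Instance = ClassicalCA d
  ; encode   = encClassical
  ; Yes      = λ A → Surjective _≗_ _≗_ (ClassicalCA.global A)
  }

StochasticPair : ℕ → Set
StochasticPair d = Σ ℕ (StochasticCA d) × Σ ℕ (StochasticCA d)

encPair : ∀ {d} → StochasticPair d → Tree
encPair (A , B) = encStochastic A · encStochastic B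

-- Equality of global functions includes equality of their domains, hence
-- of the state sets.

sameNonDet : ℕ → Problem
sameNonDet d = record
  { Instance = StochasticPair d
  ; encode   = encPair
  ; Yes      = λ { ((q , A) , (q′ , B)) →
      Σ[ q′≡q ∈ q′ ≡ q ]
        (∀ c → nonDet A c ≐ nonDet (subst (StochasticCA d) q′≡q B) c) }
  }

sameStochastic : ℕ → Problem
sameStochastic d = record
  { Instance = StochasticPair d
  ; encode   = encPair
  ; Yes      = λ { ((q , A) , (q′ , B)) →
      Σ[ q′≡q ∈ q′ ≡ q ]
        (∀ c E → stochastic A c E ≐
                 stochastic (subst (StochasticCA d) q′≡q B) c E) }
  }

{-# OPTIONS --safe #-}
module Submission where

-- A cellular automaton A with states Q becomes a pair of stochastic automata
-- that ignore the configuration: one applies A to noise over Q, the other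
-- outputs the noise.  From every configuration the second one reaches all
-- configurations, the first one those in the image of A, so the two agree
-- non-deterministically iff A is surjective (surjective⇔sameNonDet).
-- They agree stochastically iff A preserves the uniform measure ν, that is,
-- ν(A⁻¹E) = ν(E) for all Borel sets E.  The local functions of the two
-- automata have the table of A and the list of states as their tables, so
-- a WHILE program computes the pair (reductionProgram-correct).  An automaton
-- without states is sent to a fixed pair of equal automata.
--
-- If A preserves ν, then it is surjective: by compactness, a configuration
-- without preimage has a finite word without preimage, whose cylinder has
-- positive measure and an empty preimage (measure-preserving⇒surjective).
--
-- Conversely, let A be surjective.  Then A is balanced: on a large box, a
-- cylinder and its preimage hold equally many patterns (patterns-preimage).
-- It suffices that no word w has fewer preimages than the average, as the
-- numbers of preimages of all words of one shape have a fixed sum.  Otherwise,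
-- consider the patterns on a box of m^d tiles that read w in every tile.  Each
-- has a preimage, determined by a preimage of w in each tile and by the
-- symbols on a frame of O(m^(d-1)) sites.  Each tile loses a constant factor,
-- each frame site gains at most a factor of the size of Q, and for large m this
-- leaves too few preimages (patterns-preimage-≥, tiles-beat-border, box-tiling).
--
-- Balance gives ν(A⁻¹E) ≤ ν(E): in a cover of E, replace each cylinder by the
-- finitely many cylinders that make up its preimage (uniform-preimage-≤).
-- For the reverse inequality, let U be a cover of A⁻¹E.  By compactness every
-- e in E has a word all of whose preimages lie in finitely many cylinders of U
-- (eventually-good).  The shortest such words give disjoint cylinders covering
-- E; their preimages are disjoint and lie in the union of U, so by balance any
-- finitely many of them have at most the total weight of finitely many
-- cylinders of U (uniform-preimage-≥).  The argument applies to the outer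
-- measure of all sets that respect pointwise equality, so measurability is
-- never needed.  Excluded middle serves for compactness, for deciding which
-- words are good, and for counting.

open import Defs
open import Algebra.Bundles using (module AbelianGroup)
import Algebra.Properties.Group
open import Axiom.ExcludedMiddle using (ExcludedMiddle)
open import Data.Empty using (⊥; ⊥-elim)
open import Data.Fin using (Fin; zero; suc; toℕ)
open import Data.Integer as ℤ using (ℤ; -[1+_])
import Data.Integer.Properties as ℤ
import Data.Integer.Solver as ℤ
open import Data.List as List using (List; []; _∷_)
open import Data.List.Membership.Propositional using (_∈_)
open import Data.List.Membership.Propositional.Properties as ∈ˡ using ()
import Data.List.Properties as List
import Data.List.Relation.Unary.All as Allˡ
open import Data.List.Relation.Unary.AllPairs using ([]; _∷_)
open import Data.List.Relation.Unary.Any using (here; there)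
open import Data.List.Relation.Unary.Unique.Propositional using (Unique)
import Data.List.Relation.Unary.Unique.Propositional.Properties as Unique
open import Data.Maybe using (Maybe; just; nothing)
open import Data.Nat using
  ( ℕ; zero; suc; NonZero; >-nonZero; _+_; _*_; _^_; _∸_; _⊔_
  ; _≤_; _<_; _<?_; z≤n; s≤s; _≤′_; ≤′-reflexive; ≤′-step )
import Data.Nat.Properties as ℕ
import Data.Nat.Solver as ℕ
open import Data.Product using (Σ; _×_; _,_; proj₁; proj₂; ∃-syntax)
open import Data.Rational as ℚ using (ℚ; 0ℚ)
import Data.Rational.Properties as ℚ
import Data.Rational.Unnormalised as ℚᵘ
import Data.Rational.Unnormalised.Properties as ℚᵘ
open import Data.Sum using (_⊎_; inj₁; inj₂)
open import Data.Vec as Vec using (Vec; []; _∷_; lookup)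
import Data.Vec.Properties as Vec
open import Data.Vec.Relation.Unary.AllPairs using ([]; _∷_)
import Data.Vec.Relation.Unary.All as All
import Data.Vec.Relation.Unary.All.Properties as All
import Data.Vec.Relation.Unary.Unique.Propositional as Vec using (Unique)
import Data.Vec.Relation.Unary.Unique.Propositional.Properties as Vec
open import Function.Base using (_∘_; id)
open import Function.Bundles using (_⇔_; mk⇔)
open import Level using (0ℓ)
open import Relation.Binary.PropositionalEquality
  using (_≡_; refl; sym; trans; cong; cong₂; subst; subst₂; _≗_; module ≡-Reasoning)
open import Relation.Nullary using (¬_; Dec; yes; no; contradiction)
open import Relation.Nullary.Decidable using (decidable-stable)
open import Relation.Unary using (Pred)

-- The reduction

origin : ∀ {d} → Site d
origin = Vec.replicate _ (ℤ.+ 0)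

⊹-origin : ∀ {d} (z : Site d) → z ⊹ origin ≡ z
⊹-origin = Vec.zipWith-identityʳ ℤ.+-identityʳ

-- The stochastic CA that forgets the configuration and applies A to the noise.
imageOfNoise : ∀ {d} (A : ClassicalCA d) → ⦃ NonZero (ClassicalCA.#Q A) ⦄ →
               StochasticCA d (ClassicalCA.#Q A)
imageOfNoise A = record
  { #R = #Q ; V = [] ; V-unique = [] ; V′ = V ; V′-unique = V-unique ; f = λ _ → f }
  where open ClassicalCA A

-- The stochastic CA that outputs the noise itself.
pureNoise : ∀ d q → ⦃ NonZero q ⦄ → StochasticCA d q
pureNoise d q = record
  { #R = q ; V = [] ; V-unique = [] ; V′ = origin ∷ [] ; V′-unique = All.[] ∷ []
  ; f = λ { _ (r ∷ []) → r } }

-- The target for automata without states: they are surjective, having no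
-- configurations, but provide no random symbols, so they are sent to two
-- equal copies of this automaton.
oneState : ∀ d → Σ ℕ (StochasticCA d)
oneState d = 1 , record
  { #R = 1 ; V = [] ; V-unique = [] ; V′ = [] ; V′-unique = [] ; f = λ _ _ → zero }

reduction : ∀ {d} → ClassicalCA d → StochasticPair d
reduction {d} A@record { #Q = zero }  = oneState d , oneState d
reduction {d} A@record { #Q = suc _ } = (_ , imageOfNoise A) , (_ , pureNoise d (ClassicalCA.#Q A))

-- A WHILE program for the reduction

quoteTree : ∀ {k} → Tree → Exp k
quoteTree nil     = nil
quoteTree (s · t) = cons (quoteTree s) (quoteTree t)

eval-quoteTree : ∀ {k} t (σ : Store k) → eval (quoteTree t) σ ≡ t
eval-quoteTree nil     σ = refl
eval-quoteTree (s · t) σ = cong₂ _·_ (eval-quoteTree s σ) (eval-quoteTree t σ)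

-- The variables of the program.
pattern inOut   = zero
pattern counter = suc zero
pattern listing = suc (suc zero)
pattern result  = suc (suc (suc zero))
pattern flag    = suc (suc (suc (suc zero)))

-- Counting a unary number down to zero while collecting the values passed
-- lists the numbers below it in increasing order.
countdown : Cmd 5
countdown = while var counter body
  (counter ≔ tl (var counter) ⨾ listing ≔ cons (var counter) (var listing))

-- The code of the pair, computed from the code of A in `inOut` and the
-- list of all states in `listing`.
pairExp : ℕ → Exp 5
pairExp d = cons (noisy (cons V table)) (noisy (cons (quoteTree V₀) (var listing)))
  where
  q V table : Exp 5
  q     = hd (var inOut)
  V     = hd (tl (var inOut))
  table = tl (tl (var inOut))
  V₀ : Tree
  V₀ = encNbhd (origin {d} ∷ [])
  noisy : Exp 5 → Exp 5
  noisy e = cons q (cons q (cons nil e))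

-- The last loop is a conditional: its body runs once if there are states,
-- and otherwise not at all.
reductionProgram : ℕ → Program
reductionProgram d = record { code =
  counter ≔ hd (var inOut) ⨾
  countdown ⨾
  result ≔ quoteTree (encPair (oneState d , oneState d)) ⨾
  flag ≔ var listing ⨾
  (while var flag body (result ≔ pairExp d ⨾ flag ≔ nil)) ⨾
  inOut ≔ var result }

assign≡ : ∀ {k} {i : Fin k} {a σ t} → eval a σ ≡ t → ⟨ i ≔ a , σ ⟩⇓ σ Vec.[ i ]≔ t
assign≡ refl = assign

countdown-run : ∀ n xs {i r g} →
  ⟨ countdown , i ∷ encℕ n ∷ encList encℕ xs ∷ r ∷ g ∷ [] ⟩⇓
    i ∷ nil ∷ encList encℕ (List.upTo n List.++ xs) ∷ r ∷ g ∷ []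
countdown-run zero    xs = stop refl
countdown-run (suc n) xs {i} {r} {g} = loop (λ ()) (seq assign assign)
  (subst (λ ys → ⟨ countdown , i ∷ encℕ n ∷ encList encℕ (n ∷ xs) ∷ r ∷ g ∷ [] ⟩⇓
                   i ∷ nil ∷ encList encℕ ys ∷ r ∷ g ∷ [])
    snoc (countdown-run n (n ∷ xs)))
  where
  snoc : List.upTo n List.++ n ∷ xs ≡ List.upTo (suc n) List.++ xs
  snoc = trans (sym (List.++-assoc (List.upTo n) (n ∷ []) xs))
               (cong (List._++ xs) (List.upTo-∷ʳ n))

encList-map : ∀ {A B : Set} (enc : B → Tree) (g : A → B) xs →
              encList enc (List.map g xs) ≡ encList (λ x → enc (g x)) xs
encList-map enc g []       = refl
encList-map enc g (x ∷ xs) = cong (enc (g x) ·_) (encList-map enc g xs)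

-- A local function without inputs from the configuration has the same
-- table as the function of the noise alone.
cartesianProductWith-[] : ∀ {A B C : Set} (f : A → B → C) x ys →
  List.cartesianProductWith f (x ∷ []) ys ≡ List.map (f x) ys
cartesianProductWith-[] f x ys = List.++-identityʳ (List.map (f x) ys)

pureNoise-table : ∀ d q ⦃ _ : NonZero q ⦄ → let open StochasticCA (pureNoise d q) in
  encList encFin (List.cartesianProductWith f (allVecs q 0) (allVecs q 1)) ≡
  encList encℕ (List.upTo q List.++ [])
pureNoise-table d q = begin
  encList encFin (List.cartesianProductWith f (allVecs q 0) (allVecs q 1))
    ≡⟨ cong (encList encFin) (cartesianProductWith-[] f [] (allVecs q 1)) ⟩
  encList encFin (List.map (f []) (allVecs q 1))
    ≡⟨ cong (encList encFin) (singletons (List.allFin q)) ⟩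
  encList encFin (List.allFin q)
    ≡⟨ encList-map encℕ toℕ (List.allFin q) ⟨
  encList encℕ (List.map toℕ (List.allFin q))
    ≡⟨ cong (encList encℕ) (trans (List.map-tabulate (λ i → i) toℕ) (tabulate-toℕ q (λ i → i))) ⟩
  encList encℕ (List.upTo q)
    ≡⟨ cong (encList encℕ) (List.++-identityʳ (List.upTo q)) ⟨
  encList encℕ (List.upTo q List.++ []) ∎
  where
  open ≡-Reasoning
  open StochasticCA (pureNoise d q)
  singletons : ∀ is → List.map (f []) (List.cartesianProductWith _∷_ is ([] ∷ [])) ≡ is
  singletons []       = refl
  singletons (i ∷ is) = cong (i ∷_) (singletons is)
  tabulate-toℕ : ∀ n (g : ℕ → ℕ) →
    List.tabulate {n = n} (λ i → g (toℕ i)) ≡ List.applyUpTo g n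
  tabulate-toℕ zero    g = refl
  tabulate-toℕ (suc n) g = cong (g 0 ∷_) (tabulate-toℕ n (λ i → g (suc i)))

reductionProgram-correct : ∀ {d} (A : ClassicalCA d) →
  reductionProgram d maps encClassical A to encPair (reduction A)
reductionProgram-correct {d} A@record { #Q = zero } = _ ,
  seq assign (seq (countdown-run 0 []) (seq
    (assign≡ (eval-quoteTree (encPair (oneState d , oneState d))
      (encClassical A ∷ nil ∷ nil ∷ nil ∷ nil ∷ [])))
    (seq assign (seq (stop refl) assign))))
reductionProgram-correct {d} A@record { #Q = suc n } = _ ,
  seq assign (seq (countdown-run (suc n) []) (seq
    (assign≡ (eval-quoteTree (encPair (oneState d , oneState d))
      (encClassical A ∷ nil ∷ states ∷ nil ∷ nil ∷ [])))
    (seq assign (seq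
      (loop (λ ()) (seq (assign≡ output-correct) assign) (stop refl)) assign))))
  where
  open ClassicalCA A
  states : Tree
  states = encList encℕ (List.upTo (suc n) List.++ [])
  output-correct : ∀ {c r g} →
    eval (pairExp d) (encClassical A ∷ c ∷ states ∷ r ∷ g ∷ []) ≡ encPair (reduction A)
  output-correct {c} {r} {g} =
    cong₂ (λ s t → (encℕ #Q · encℕ #Q · nil · encNbhd V · s) ·
                   (encℕ #Q · encℕ #Q · nil · t))
      (cong (encList encFin) (sym
        (cartesianProductWith-[] (λ (_ : Vec (Fin (suc n)) 0) → f) [] (allVecs #Q ρ))))
      (cong₂ _·_
        (eval-quoteTree (encNbhd (origin {d} ∷ []))
          (encClassical A ∷ c ∷ states ∷ r ∷ g ∷ []))
        (sym (pureNoise-table d #Q)))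

-- The non-deterministic case

around-cong : ∀ {d n k} {c c′ : Config d n} → c ≗ c′ → ∀ z (V : Vec (Site d) k) →
              around c z V ≡ around c′ z V
around-cong c≗c′ z V = Vec.map-cong (λ v → c≗c′ (z ⊹ v)) V

global-cong : ∀ {d} (A : ClassicalCA d) {x y} → x ≗ y →
              ClassicalCA.global A x ≗ ClassicalCA.global A y
global-cong A x≗y z = cong (ClassicalCA.f A) (around-cong x≗y z (ClassicalCA.V A))

surjective⇔sameNonDet : ∀ {d} (A : ClassicalCA d) →
  Problem.Yes (surjectivity d) A ⇔ Problem.Yes (sameNonDet d) (reduction A)
surjective⇔sameNonDet A@record { #Q = zero } = mk⇔
  (λ _ → refl , λ _ → (λ {_} h → h) , λ {_} h → h)
  (λ _ y → ⊥-elim (no-state (y origin)))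
  where
  no-state : Fin 0 → ⊥
  no-state ()
surjective⇔sameNonDet {d} A@record { #Q = suc _ } = mk⇔
  (λ surj → refl , λ c →
    (λ { {e} _ → e , λ z → cong e (⊹-origin z) }) ,
    (λ { {e} _ → proj₁ (surj e) , proj₂ (surj e) (λ _ → refl) }))
  onto
  where
  onto : Problem.Yes (sameNonDet d) (reduction A) → Problem.Yes (surjectivity d) A
  onto (refl , same) y with proj₂ (same (λ _ → zero)) (y , λ z → cong y (⊹-origin z))
  ... | s , Fs≗y = s , λ z≗s i → trans (global-cong A z≗s i) (Fs≗y i)

-- Counting in lists

-- All vectors of length n with entries from a list, with repetition.
power : ∀ {A : Set} → List A → ∀ n → List (Vec A n)
power xs zero    = [] ∷ []
power xs (suc n) = List.cartesianProductWith _∷_ xs (power xs n)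

allVecs≡power : ∀ q k → allVecs q k ≡ power (List.allFin q) k
allVecs≡power q zero    = refl
allVecs≡power q (suc k) = cong (List.cartesianProductWith _∷_ (List.allFin q)) (allVecs≡power q k)

length-cartesianProductWith : ∀ {A B C : Set} (f : A → B → C) xs ys →
  List.length (List.cartesianProductWith f xs ys) ≡ List.length xs * List.length ys
length-cartesianProductWith f []       ys = refl
length-cartesianProductWith f (x ∷ xs) ys = trans
  (List.length-++ (List.map (f x) ys))
  (cong₂ _+_ (List.length-map (f x) ys) (length-cartesianProductWith f xs ys))

length-power : ∀ {A : Set} (xs : List A) n → List.length (power xs n) ≡ List.length xs ^ n
length-power xs zero    = refl
length-power xs (suc n) = trans (length-cartesianProductWith _∷_ xs (power xs n))
  (cong (List.length xs *_) (length-power xs n))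

power-unique : ∀ {A : Set} {xs : List A} → Unique xs → ∀ n → Unique (power xs n)
power-unique xs! zero    = Allˡ.[] ∷ []
power-unique xs! (suc n) = Unique.cartesianProductWith⁺ _∷_ Vec.∷-injective xs! (power-unique xs! n)

∈-power⁺ : ∀ {A : Set} {xs : List A} {n} (v : Vec A n) →
           (∀ i → lookup v i ∈ xs) → v ∈ power xs n
∈-power⁺ []      _  = here refl
∈-power⁺ (_ ∷ v) v∈ = ∈ˡ.∈-cartesianProductWith⁺ _∷_ (v∈ zero) (∈-power⁺ v (v∈ ∘ suc))

∈-power⁻ : ∀ {A : Set} {xs : List A} {n} {v : Vec A n} →
           v ∈ power xs n → ∀ i → lookup v i ∈ xs
∈-power⁻ {xs = xs} {suc n} v∈ i
  with x , w , x∈ , w∈ , refl ← ∈ˡ.∈-cartesianProductWith⁻ _∷_ xs (power xs n) v∈ | i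
... | zero  = x∈
... | suc j = ∈-power⁻ w∈ j

length-allVecs : ∀ q k → List.length (allVecs q k) ≡ q ^ k
length-allVecs q k = trans (cong List.length (allVecs≡power q k)) (trans
  (length-power (List.allFin q) k) (cong (_^ k) (List.length-tabulate id)))

allVecs-unique : ∀ q k → Unique (allVecs q k)
allVecs-unique q k = subst Unique (sym (allVecs≡power q k)) (power-unique (Unique.allFin⁺ q) k)

∈-allVecs : ∀ {q k} (v : Vec (Fin q) k) → v ∈ allVecs q k
∈-allVecs {q} {k} v = subst (v ∈_) (sym (allVecs≡power q k))
  (∈-power⁺ v (λ i → ∈ˡ.∈-allFin (lookup v i)))

-- The pigeonhole principle.
injection⇒length≤ : ∀ {A B : Set} (h : A → B) {xs ys} → Unique xs →
  (∀ {x} → x ∈ xs → h x ∈ ys) →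
  (∀ {x y} → x ∈ xs → y ∈ xs → h x ≡ h y → x ≡ y) →
  List.length xs ≤ List.length ys
injection⇒length≤ h {[]} _ _ _ = z≤n
injection⇒length≤ h {x ∷ xs} {ys} (x∉xs ∷ xs!) h∈ inj
  with as , bs , refl ← ∈ˡ.∈-∃++ (h∈ (here refl)) = begin
    suc (List.length xs)
      ≤⟨ s≤s (injection⇒length≤ h xs! h∈′ (λ y∈ z∈ → inj (there y∈) (there z∈))) ⟩
    suc (List.length (as List.++ bs))
      ≡⟨ cong suc (List.length-++ as) ⟩
    suc (List.length as + List.length bs)
      ≡⟨ ℕ.+-suc (List.length as) (List.length bs) ⟨
    List.length as + List.length (h x ∷ bs)
      ≡⟨ List.length-++ as ⟨
    List.length (as List.++ h x ∷ bs) ∎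
  where
  open ℕ.≤-Reasoning
  h∈′ : ∀ {y} → y ∈ xs → h y ∈ as List.++ bs
  h∈′ {y} y∈ with ∈ˡ.∈-++⁻ as (h∈ (there y∈))
  ... | inj₁ hy∈as         = ∈ˡ.∈-++⁺ˡ hy∈as
  ... | inj₂ (there hy∈bs) = ∈ˡ.∈-++⁺ʳ as hy∈bs
  ... | inj₂ (here hy≡hx)  = contradiction
    (inj (here refl) (there y∈) (sym hy≡hx)) (Allˡ.lookup x∉xs y∈)

-- Summation over the entries of a list, with repetition.
∑ : ∀ {A : Set} → List A → (A → ℕ) → ℕ
∑ []       φ = 0
∑ (x ∷ xs) φ = φ x + ∑ xs φ

∑-mono : ∀ {A : Set} (xs : List A) {φ ψ} → (∀ x → φ x ≤ ψ x) → ∑ xs φ ≤ ∑ xs ψ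
∑-mono []       _   = z≤n
∑-mono (x ∷ xs) φ≤ψ = ℕ.+-mono-≤ (φ≤ψ x) (∑-mono xs φ≤ψ)

∑-cong : ∀ {A : Set} (xs : List A) {φ ψ} → (∀ x → φ x ≡ ψ x) → ∑ xs φ ≡ ∑ xs ψ
∑-cong []       _   = refl
∑-cong (x ∷ xs) φ≡ψ = cong₂ _+_ (φ≡ψ x) (∑-cong xs φ≡ψ)

∑-+ : ∀ {A : Set} (xs : List A) φ ψ → ∑ xs (λ x → φ x + ψ x) ≡ ∑ xs φ + ∑ xs ψ
∑-+ []       φ ψ = refl
∑-+ (x ∷ xs) φ ψ = trans (cong ((φ x + ψ x) +_) (∑-+ xs φ ψ))
  (solve 4 (λ a b c d → (a :+ b) :+ (c :+ d) := (a :+ c) :+ (b :+ d)) refl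
    (φ x) (ψ x) (∑ xs φ) (∑ xs ψ))
  where open ℕ.+-*-Solver

∑-const : ∀ {A : Set} (xs : List A) m → ∑ xs (λ _ → m) ≡ List.length xs * m
∑-const []       m = refl
∑-const (_ ∷ xs) m = cong (m +_) (∑-const xs m)

∑-swap : ∀ {A B : Set} (xs : List A) (ys : List B) (φ : A → B → ℕ) →
         ∑ xs (λ x → ∑ ys (φ x)) ≡ ∑ ys (λ y → ∑ xs (λ x → φ x y))
∑-swap []       ys φ = sym (trans (∑-const ys 0) (ℕ.*-zeroʳ (List.length ys)))
∑-swap (x ∷ xs) ys φ = trans (cong (∑ ys (φ x) +_) (∑-swap xs ys φ))
  (sym (∑-+ ys (φ x) (λ y → ∑ xs (λ x → φ x y))))

indicator : ∀ {P : Set} → Dec P → ℕ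
indicator (yes _) = 1
indicator (no _)  = 0

-- Excluded middle makes every predicate decidable, hence countable.
module Counting (em : ExcludedMiddle 0ℓ) where

  -- The number of entries with a property, with repetition.
  count : ∀ {A : Set} → Pred A 0ℓ → List A → ℕ
  count P xs = ∑ xs (λ x → indicator (em {P x}))

  sieve : ∀ {A : Set} → Pred A 0ℓ → List A → List A
  sieve P = List.filter (λ x → em {P x})

  ∈-sieve⁺ : ∀ {A : Set} {P : Pred A 0ℓ} {xs x} → x ∈ xs → P x → x ∈ sieve P xs
  ∈-sieve⁺ = ∈ˡ.∈-filter⁺ (λ _ → em)

  ∈-sieve⁻ : ∀ {A : Set} {P : Pred A 0ℓ} {xs x} → x ∈ sieve P xs → x ∈ xs × P x
  ∈-sieve⁻ = ∈ˡ.∈-filter⁻ (λ _ → em)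

  length-sieve : ∀ {A : Set} (P : Pred A 0ℓ) xs → List.length (sieve P xs) ≡ count P xs
  length-sieve P []       = refl
  length-sieve P (x ∷ xs) with em {P x}
  ... | yes _ = cong suc (length-sieve P xs)
  ... | no  _ = length-sieve P xs

  count-mono : ∀ {A : Set} {P Q : Pred A 0ℓ} xs → (∀ {x} → P x → Q x) → count P xs ≤ count Q xs
  count-mono {P = P} {Q} xs P⊆Q = ∑-mono xs pointwise
    where
    pointwise : ∀ x → indicator (em {P x}) ≤ indicator (em {Q x})
    pointwise x with em {P x} | em {Q x}
    ... | yes p | no ¬q = contradiction (P⊆Q p) ¬q
    ... | yes _ | yes _ = ℕ.≤-refl
    ... | no  _ | _     = z≤n

  count-⊎ : ∀ {A : Set} {P Q : Pred A 0ℓ} xs →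
            count (λ x → P x ⊎ Q x) xs ≤ count P xs + count Q xs
  count-⊎ {P = P} {Q} xs = ℕ.≤-trans (∑-mono xs pointwise) (ℕ.≤-reflexive (∑-+ xs _ _))
    where
    pointwise : ∀ x → indicator (em {P x ⊎ Q x}) ≤ indicator (em {P x}) + indicator (em {Q x})
    pointwise x with em {P x ⊎ Q x} | em {P x} | em {Q x}
    ... | no _         | _     | _     = z≤n
    ... | yes _        | yes _ | _     = s≤s z≤n
    ... | yes _        | no _  | yes _ = s≤s z≤n
    ... | yes (inj₁ p) | no ¬p | no _  = contradiction p ¬p
    ... | yes (inj₂ q) | no _  | no ¬q = contradiction q ¬q

  count-disjoint : ∀ {A : Set} {P Q R : Pred A 0ℓ} xs → (∀ {x} → P x → R x) → (∀ {x} → Q x → R x) →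
                   (∀ {x} → P x → ¬ Q x) → count P xs + count Q xs ≤ count R xs
  count-disjoint {P = P} {Q} {R} xs P⊆R Q⊆R P∩Q=∅ =
    ℕ.≤-trans (ℕ.≤-reflexive (sym (∑-+ xs _ _))) (∑-mono xs pointwise)
    where
    pointwise : ∀ x → indicator (em {P x}) + indicator (em {Q x}) ≤ indicator (em {R x})
    pointwise x with em {P x} | em {Q x} | em {R x}
    ... | yes p | yes q | _     = contradiction q (P∩Q=∅ p)
    ... | yes p | no _  | no ¬r = contradiction (P⊆R p) ¬r
    ... | yes _ | no _  | yes _ = ℕ.≤-refl
    ... | no _  | yes q | no ¬r = contradiction (Q⊆R q) ¬r
    ... | no _  | yes _ | yes _ = ℕ.≤-refl
    ... | no _  | no _  | _     = z≤n

  count-false : ∀ {A : Set} {P : Pred A 0ℓ} xs → (∀ {x} → x ∈ xs → ¬ P x) → count P xs ≡ 0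
  count-false []       _  = refl
  count-false {P = P} (x ∷ xs) ¬P with em {P x}
  ... | yes p = contradiction p (¬P (here refl))
  ... | no _  = count-false xs (¬P ∘ there)

  count-singleton : ∀ {A : Set} {xs : List A} {a} → Unique xs → a ∈ xs → count (a ≡_) xs ≡ 1
  count-singleton {xs = x ∷ xs} {a} (x∉xs ∷ xs!) a∈ with em {a ≡ x} | a∈
  ... | yes refl | _          = cong suc (count-false xs λ y∈ → Allˡ.lookup x∉xs y∈)
  ... | no a≢x   | here a≡x   = contradiction a≡x a≢x
  ... | no _     | there a∈xs = count-singleton xs! a∈xs

  -- The fibres of a map partition its domain.
  ∑-count-fibres : ∀ {A B : Set} (xs : List A) {ws : List B} → Unique ws → (φ : A → B) →
    ∑ ws (λ w → count (λ x → φ x ≡ w) xs) ≡ count (λ x → φ x ∈ ws) xs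
  ∑-count-fibres xs {ws} ws! φ = trans (∑-swap ws xs _) (∑-cong xs pointwise)
    where
    pointwise : ∀ x → count (φ x ≡_) ws ≡ indicator (em {φ x ∈ ws})
    pointwise x with em {φ x ∈ ws}
    ... | yes φx∈ = count-singleton ws! φx∈
    ... | no φx∉  = count-false ws λ { w∈ refl → φx∉ w∈ }

  count-true : ∀ {A : Set} {P : Pred A 0ℓ} xs → (∀ x → P x) → count P xs ≡ List.length xs
  count-true {P = P} xs all = trans (∑-cong xs pointwise) (trans (∑-const xs 1) (ℕ.*-identityʳ _))
    where
    pointwise : ∀ x → indicator (em {P x}) ≡ 1
    pointwise x with em {P x}
    ... | yes _ = refl
    ... | no ¬p = contradiction (all x) ¬p

  injection⇒count≤ : ∀ {A B : Set} {P : Pred A 0ℓ} {Q : Pred B 0ℓ} {xs ys} (h : A → B) →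
    Unique xs → (∀ x → h x ∈ ys) → (∀ {x} → P x → Q (h x)) →
    (∀ {x y} → P x → P y → h x ≡ h y → x ≡ y) → count P xs ≤ count Q ys
  injection⇒count≤ {P = P} {Q} {xs} {ys} h xs! h∈ hP inj = begin
    count P xs               ≡⟨ length-sieve P xs ⟨
    List.length (sieve P xs) ≤⟨ injection⇒length≤ h (Unique.filter⁺ (λ _ → em) xs!)
                                  (λ x∈ → ∈-sieve⁺ (h∈ _) (hP (holds x∈)))
                                  (λ x∈ y∈ → inj (holds x∈) (holds y∈)) ⟩
    List.length (sieve Q ys) ≡⟨ length-sieve Q ys ⟩
    count Q ys               ∎
    where
    open ℕ.≤-Reasoning
    holds : ∀ {x} → x ∈ sieve P xs → P x
    holds x∈ = proj₂ (∈-sieve⁻ {xs = xs} x∈)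

-- Finite windows and their patterns

_≟ˢ_ : ∀ {d} (z z′ : Site d) → Dec (z ≡ z′)
_≟ˢ_ = Vec.≡-dec ℤ._≟_

infix 4 _∈ᵛ_ _⊆ᵛ_

-- Membership by an index, for use with lookup.
_∈ᵛ_ : ∀ {A : Set} {n} → A → Vec A n → Set
z ∈ᵛ V = ∃[ i ] lookup V i ≡ z

_⊆ᵛ_ : ∀ {A : Set} {m n} → Vec A m → Vec A n → Set
V ⊆ᵛ W = ∀ i → lookup V i ∈ᵛ W

-- A finite set of sites, listed without repetition.
record Window (d : ℕ) : Set where
  field
    {size}   : ℕ
    sites    : Vec (Site d) size
    distinct : Vec.Unique sites

open Window

∈-fromList⁺ : ∀ {A : Set} {x : A} {xs} → x ∈ xs → x ∈ᵛ Vec.fromList xs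
∈-fromList⁺ (here refl) = zero , refl
∈-fromList⁺ (there x∈)  = let i , eq = ∈-fromList⁺ x∈ in suc i , eq

∈-fromList⁻ : ∀ {A : Set} (xs : List A) i → lookup (Vec.fromList xs) i ∈ xs
∈-fromList⁻ (x ∷ xs) zero    = here refl
∈-fromList⁻ (x ∷ xs) (suc i) = there (∈-fromList⁻ xs i)

fromList-unique : ∀ {A : Set} {xs : List A} → Unique xs → Vec.Unique (Vec.fromList xs)
fromList-unique []           = []
fromList-unique (x∉xs ∷ xs!) = All.fromList⁺ x∉xs ∷ fromList-unique xs!

map-≡⁻ : ∀ {A B : Set} {n} {x y : A → B} (V : Vec A n) → Vec.map x V ≡ Vec.map y V →
         ∀ {z} → z ∈ᵛ V → x z ≡ y z
map-≡⁻ {x = x} {y} V eq (i , refl) = begin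
  x (lookup V i)         ≡⟨ Vec.lookup-map i x V ⟨
  lookup (Vec.map x V) i ≡⟨ cong (λ as → lookup as i) eq ⟩
  lookup (Vec.map y V) i ≡⟨ Vec.lookup-map i y V ⟩
  y (lookup V i)         ∎
  where open ≡-Reasoning

map-≡⁺ : ∀ {A B : Set} {n} {x y : A → B} (V : Vec A n) → (∀ {z} → z ∈ᵛ V → x z ≡ y z) →
         Vec.map x V ≡ Vec.map y V
map-≡⁺ []      _     = refl
map-≡⁺ (z ∷ V) agree = cong₂ _∷_ (agree (zero , refl)) (map-≡⁺ V (λ (i , eq) → agree (suc i , eq)))

map-≡-⊆ : ∀ {A B : Set} {m n} {V : Vec A m} {W : Vec A n} {x y : A → B} → V ⊆ᵛ W →
          Vec.map x W ≡ Vec.map y W → Vec.map x V ≡ Vec.map y V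
map-≡-⊆ {V = V} {W} V⊆W eq = map-≡⁺ V λ { (i , refl) → map-≡⁻ W eq (V⊆W i) }

-- The configuration that reads a on the window and x elsewhere.
override : ∀ {d q n} → Vec (Site d) n → Vec (Fin q) n → Config d q → Config d q
override []      []       x z = x z
override (v ∷ V) (a ∷ as) x z with z ≟ˢ v
... | yes _ = a
... | no  _ = override V as x z

override-lookup : ∀ {d q n} {V : Vec (Site d) n} → Vec.Unique V → (a : Vec (Fin q) n) → ∀ x i →
                  override V a x (lookup V i) ≡ lookup a i
override-lookup {V = v ∷ V} (v∉V ∷ V!) (a ∷ as) x zero with v ≟ˢ v
... | yes _  = refl
... | no v≢v = contradiction refl v≢v
override-lookup {V = v ∷ V} (v∉V ∷ V!) (a ∷ as) x (suc i) with lookup V i ≟ˢ v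
... | yes eq = contradiction (sym eq) (All.lookup⁺ v∉V i)
... | no _   = override-lookup V! as x i

lookup-≡⇒≡ : ∀ {A : Set} {n} {v w : Vec A n} → (∀ i → lookup v i ≡ lookup w i) → v ≡ w
lookup-≡⇒≡ {v = []}    {[]}    _  = refl
lookup-≡⇒≡ {v = x ∷ v} {y ∷ w} eq = cong₂ _∷_ (eq zero) (lookup-≡⇒≡ (eq ∘ suc))

override-∈ : ∀ {d q n} {V : Vec (Site d) n} → Vec.Unique V → (a : Vec (Fin q) n) → ∀ x →
             Vec.map (override V a x) V ≡ a
override-∈ {V = V} V! a x = lookup-≡⇒≡ λ i →
  trans (Vec.lookup-map i (override V a x) V) (override-lookup V! a x i)

override-∉ : ∀ {d q n} (V : Vec (Site d) n) (a : Vec (Fin q) n) x {z} →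
             ¬ z ∈ᵛ V → override V a x z ≡ x z
override-∉ []      []       x _ = refl
override-∉ (v ∷ V) (a ∷ as) x {z} z∉ with z ≟ˢ v
... | yes refl = contradiction (zero , refl) z∉
... | no _     = override-∉ V as x (λ (i , eq) → z∉ (suc i , eq))

-- K contains the V-neighbourhoods of all sites of D.
Neighbourhood⊆ : ∀ {d k m n} → Vec (Site d) k → Vec (Site d) m → Vec (Site d) n → Set
Neighbourhood⊆ V D K = ∀ i j → lookup D i ⊹ lookup V j ∈ᵛ K

around-≡ : ∀ {d q k} (V : Vec (Site d) k) (x y : Config d q) {z z′} →
  (∀ j → x (z ⊹ lookup V j) ≡ y (z′ ⊹ lookup V j)) → around x z V ≡ around y z′ V
around-≡ V x y eq = lookup-≡⇒≡ λ j →
  trans (Vec.lookup-map j _ V) (trans (eq j) (sym (Vec.lookup-map j _ V)))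

global-local : ∀ {d} (A : ClassicalCA d) {m n} {D : Vec (Site d) m} {K : Vec (Site d) n} →
  Neighbourhood⊆ (ClassicalCA.V A) D K → ∀ x y → Vec.map x K ≡ Vec.map y K →
  Vec.map (ClassicalCA.global A x) D ≡ Vec.map (ClassicalCA.global A y) D
global-local A {D = D} {K} D+V⊆K x y eq = map-≡⁺ D λ { (i , refl) →
  cong (ClassicalCA.f A) (around-≡ (ClassicalCA.V A) x y (λ j → map-≡⁻ K eq (D+V⊆K i j))) }

-- The symbol blank fills the complement of a window, which makes a pattern
-- on the window a configuration.
module Patterns (em : ExcludedMiddle 0ℓ) {d q : ℕ} (blank : Fin q) where

  open Counting em

  extend : ∀ {k} → Vec (Site d) k → Vec (Fin q) k → Config d q
  extend K p = override K p (λ _ → blank)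

  -- The number of patterns on K whose extension has the property P.
  patterns : ∀ {k} → Vec (Site d) k → Pred (Config d q) 0ℓ → ℕ
  patterns {k} K P = count (P ∘ extend K) (allVecs q k)

  module _ {k} {K : Vec (Site d) k} (K! : Vec.Unique K) where

    map-extend : ∀ p → Vec.map (extend K p) K ≡ p
    map-extend p = override-∈ K! p _

    ∑-patterns : ∀ {n} (φ : Config d q → Vec (Fin q) n) →
      ∑ (allVecs q n) (λ w → patterns K (λ x → φ x ≡ w)) ≡ q ^ k
    ∑-patterns {n} φ = begin
      ∑ (allVecs q n) (λ w → patterns K (λ x → φ x ≡ w))
        ≡⟨ ∑-count-fibres (allVecs q k) (allVecs-unique q n) (φ ∘ extend K) ⟩
      count (λ p → φ (extend K p) ∈ allVecs q n) (allVecs q k)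
        ≡⟨ count-true (allVecs q k) (λ p → ∈-allVecs (φ (extend K p))) ⟩
      List.length (allVecs q k)
        ≡⟨ length-allVecs q k ⟩
      q ^ k ∎
      where open ≡-Reasoning

    module _ {n} {D : Vec (Site d) n} (D! : Vec.Unique D) (D⊆K : D ⊆ᵛ K) where

      -- Overwriting a by b on D maps the patterns that read a on D
      -- injectively to those that read b.
      patterns-cylinder-≤ : ∀ a b →
        patterns K (λ x → Vec.map x D ≡ a) ≤ patterns K (λ x → Vec.map x D ≡ b)
      patterns-cylinder-≤ a b = injection⇒count≤ write (allVecs-unique q k) (λ _ → ∈-allVecs _)
        (λ {p} _ → trans (map-≡-⊆ D⊆K (map-extend (write p))) (override-∈ D! b (extend K p)))
        write-injective
        where
        write : Vec (Fin q) k → Vec (Fin q) k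
        write p = Vec.map (override D b (extend K p)) K
        write-injective : ∀ {p p′} → Vec.map (extend K p) D ≡ a → Vec.map (extend K p′) D ≡ a →
                          write p ≡ write p′ → p ≡ p′
        write-injective {p} {p′} p∈a p′∈a eq =
          trans (sym (map-extend p)) (trans (map-≡⁺ K agree) (map-extend p′))
          where
          agree : ∀ {z} → z ∈ᵛ K → extend K p z ≡ extend K p′ z
          agree {z} z∈K with em {z ∈ᵛ D}
          ... | yes z∈D = map-≡⁻ D (trans p∈a (sym p′∈a)) z∈D
          ... | no z∉D  = begin
            extend K p z                   ≡⟨ override-∉ D b (extend K p) z∉D ⟨
            override D b (extend K p) z    ≡⟨ map-≡⁻ K eq z∈K ⟩
            override D b (extend K p′) z   ≡⟨ override-∉ D b (extend K p′) z∉D ⟩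
            extend K p′ z                  ∎
            where open ≡-Reasoning

      -- Each of the q ^ n words on D is read by equally many of the q ^ k
      -- patterns on K.
      patterns-cylinder : ∀ a → q ^ n * patterns K (λ x → Vec.map x D ≡ a) ≡ q ^ k
      patterns-cylinder a = begin
        q ^ n * N a                           ≡⟨ cong (_* N a) (length-allVecs q n) ⟨
        List.length (allVecs q n) * N a       ≡⟨ ∑-const (allVecs q n) (N a) ⟨
        ∑ (allVecs q n) (λ _ → N a)           ≡⟨ ∑-cong (allVecs q n) (λ b →
                                                   ℕ.≤-antisym (patterns-cylinder-≤ a b)
                                                               (patterns-cylinder-≤ b a)) ⟩
        ∑ (allVecs q n) N                     ≡⟨ ∑-patterns (λ x → Vec.map x D) ⟩
        q ^ k                                 ∎
        where
        open ≡-Reasoning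
        N : Vec (Fin q) n → ℕ
        N b = patterns K (λ x → Vec.map x D ≡ b)

-- Surjective cellular automata are balanced

-- Bernoulli's inequality for (1 + 1/n) ^ (k + 1), without denominators.
bernoulli : ∀ n k → n ^ suc k + suc k * n ^ k ≤ suc n ^ suc k
bernoulli n zero    = ℕ.≤-reflexive
  (solve 1 (λ n → n :* con 1 :+ con 1 := con 1 :* con 1 :+ n :* con 1) refl n)
  where open ℕ.+-*-Solver
bernoulli n (suc k) = begin
  n ^ suc (suc k) + suc (suc k) * n ^ suc k
    ≡⟨ solve 3 (λ n m p → n :* (n :* p) :+ (con 1 :+ m) :* (n :* p)
                          := (n :* p) :+ n :* (n :* p :+ m :* p))
         refl n (suc k) (n ^ k) ⟩
  n ^ suc k + n * (n ^ suc k + suc k * n ^ k)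
    ≤⟨ ℕ.+-mono-≤ (ℕ.^-monoˡ-≤ (suc k) (ℕ.n≤1+n n)) (ℕ.*-monoʳ-≤ n (bernoulli n k)) ⟩
  suc n ^ suc k + n * suc n ^ suc k ∎
  where
  open ℕ.≤-Reasoning
  open ℕ.+-*-Solver

2*m^n≤n^n : ∀ {m n} → m < n → 2 * m ^ n ≤ n ^ n
2*m^n≤n^n {m} {suc k} m<n = begin
  2 * m ^ suc k                 ≡⟨ cong (m ^ suc k +_) (ℕ.+-identityʳ (m ^ suc k)) ⟩
  m ^ suc k + m * m ^ k         ≤⟨ ℕ.+-monoʳ-≤ (m ^ suc k) (ℕ.*-monoˡ-≤ (m ^ k) (ℕ.<⇒≤ m<n)) ⟩
  m ^ suc k + suc k * m ^ k     ≤⟨ bernoulli m k ⟩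
  suc m ^ suc k                 ≤⟨ ℕ.^-monoˡ-≤ (suc k) m<n ⟩
  suc k ^ suc k                 ∎
  where open ℕ.≤-Reasoning

^-distribʳ-* : ∀ k m n → (m * n) ^ k ≡ m ^ k * n ^ k
^-distribʳ-* zero    m n = refl
^-distribʳ-* (suc k) m n = trans (cong (m * n *_) (^-distribʳ-* k m n))
  (solve 4 (λ m n x y → m :* n :* (x :* y) := m :* x :* (n :* y)) refl m n (m ^ k) (n ^ k))
  where open ℕ.+-*-Solver

n≤2^n : ∀ n → n ≤ 2 ^ n
n≤2^n zero    = z≤n
n≤2^n (suc n) = begin
  suc n           ≤⟨ ℕ.+-mono-≤ (ℕ.m^n>0 2 n) (n≤2^n n) ⟩
  2 ^ n + 2 ^ n   ≡⟨ cong (2 ^ n +_) (ℕ.+-identityʳ (2 ^ n)) ⟨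
  2 ^ suc n       ∎
  where open ℕ.≤-Reasoning

-- The loss of a factor (Y / N) in each of t tiles beats the gain of a
-- factor q at each of b border sites once t is large compared with b.
tiles-beat-border : ∀ {N Y q t b J} → N < Y → 1 ≤ q → t ≡ (Y * q) * J → b < J →
                    ¬ Y ^ t ≤ N ^ t * q ^ b
tiles-beat-border {N} {Y@(suc _)} {q@(suc _)} {b = b} {J} N<Y _ refl b<J le = ℕ.<⇒≱ q^b<2^qJ
  (ℕ.*-cancelˡ-≤ (Y ^ t) ⦃ ℕ.m^n≢0 Y t ⦄ (begin
    Y ^ t * 2 ^ (q * J)             ≤⟨ ℕ.*-monoˡ-≤ (2 ^ (q * J)) le ⟩
    N ^ t * q ^ b * 2 ^ (q * J)     ≡⟨ solve 3 (λ x y z → x :* y :* z := (z :* x) :* y) refl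
                                         (N ^ t) (q ^ b) (2 ^ (q * J)) ⟩
    2 ^ (q * J) * N ^ t * q ^ b     ≤⟨ ℕ.*-monoˡ-≤ (q ^ b) 2^qJ*N^t≤Y^t ⟩
    Y ^ t * q ^ b                   ∎))
  where
  open ℕ.≤-Reasoning
  open ℕ.+-*-Solver
  t = (Y * q) * J
  power-t : ∀ m → m ^ t ≡ (m ^ Y) ^ (q * J)
  power-t m = trans (cong (m ^_) (ℕ.*-assoc Y q J)) (sym (ℕ.^-*-assoc m Y (q * J)))
  2^qJ*N^t≤Y^t : 2 ^ (q * J) * N ^ t ≤ Y ^ t
  2^qJ*N^t≤Y^t = begin
    2 ^ (q * J) * N ^ t             ≡⟨ cong (2 ^ (q * J) *_) (power-t N) ⟩
    2 ^ (q * J) * (N ^ Y) ^ (q * J) ≡⟨ ^-distribʳ-* (q * J) 2 (N ^ Y) ⟨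
    (2 * N ^ Y) ^ (q * J)           ≤⟨ ℕ.^-monoˡ-≤ (q * J) (2*m^n≤n^n N<Y) ⟩
    (Y ^ Y) ^ (q * J)               ≡⟨ power-t Y ⟨
    Y ^ t                           ∎
  q^b<2^qJ : q ^ b < 2 ^ (q * J)
  q^b<2^qJ = begin-strict
    q ^ b                           ≤⟨ ℕ.^-monoˡ-≤ b (n≤2^n q) ⟩
    (2 ^ q) ^ b                     ≡⟨ ℕ.^-*-assoc 2 q b ⟩
    2 ^ (q * b)                     <⟨ ℕ.^-monoʳ-< 2 (s≤s (s≤s z≤n)) (ℕ.*-monoʳ-< q b<J) ⟩
    2 ^ (q * J)                     ∎

-- Disjoint translates of K, the tiles, and a border such that V-neighbours of
-- sites in the tiles are in the tiles or in the border.  There are C * factor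
-- tiles and fewer than factor border sites.
record Tiling {d ρ k} (V : Vec (Site d) ρ) (K : Vec (Site d) k) (C : ℕ) : Set where
  field
    {#tiles #border} : ℕ
    factor   : ℕ
    tiles    : Vec (Site d) #tiles
    border   : Vec (Site d) #border
    disjoint : ∀ {i i′ j j′} → lookup tiles i ⊹ lookup K j ≡ lookup tiles i′ ⊹ lookup K j′ →
               i ≡ i′ × j ≡ j′
    closed   : ∀ i j v → let z = (lookup tiles i ⊹ lookup K j) ⊹ lookup V v in
               (∃[ i′ ] ∃[ j′ ] lookup tiles i′ ⊹ lookup K j′ ≡ z) ⊎ z ∈ᵛ border
    many     : #tiles ≡ C * factor
    few      : #border < factor

⊹-assoc : ∀ {d} (x y z : Site d) → (x ⊹ y) ⊹ z ≡ x ⊹ (y ⊹ z)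
⊹-assoc = Vec.zipWith-assoc ℤ.+-assoc

Surjective : ∀ {d} → ClassicalCA d → Set
Surjective {d} = Problem.Yes (surjectivity d)

-- The number of preimages of a pattern w on D, counted on a window K that
-- contains D and its neighbourhood, is at least the number of patterns on K
-- that read w, which is the average.  Otherwise, a large tiling has more
-- patterns that read w in each tile than their preimages can distinguish.
module Balance (em : ExcludedMiddle 0ℓ) {d} (A : ClassicalCA d) (surj : Surjective A)
  (blank : Fin (ClassicalCA.#Q A))
  {n} {D : Vec (Site d) n} (D! : Vec.Unique D) (w : Vec (Fin (ClassicalCA.#Q A)) n)
  {k} {K : Vec (Site d) k} (K! : Vec.Unique K)
  (D⊆K : D ⊆ᵛ K) (D+V⊆K : Neighbourhood⊆ (ClassicalCA.V A) D K)
  where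

  open ClassicalCA A using (V; f; global) renaming (#Q to q)
  open Counting em
  open Patterns em {d} blank

  -- The configurations that read w on D, and their preimages.
  Target Source : Pred (Config d q) 0ℓ
  Target x = Vec.map x D ≡ w
  Source x = Vec.map (global x) D ≡ w

  targets sources : List (Vec (Fin q) k)
  targets = sieve (Target ∘ extend K) (allVecs q k)
  sources = sieve (Source ∘ extend K) (allVecs q k)

  module _ {C} (tiling : Tiling V K C) where

    open Tiling tiling

    site : Fin #tiles → Fin k → Site d
    site i j = lookup tiles i ⊹ lookup K j

    -- The configuration with the given patterns in the tiles.
    paint : Vec (Vec (Fin q) k) #tiles → Config d q
    paint g z with em {∃[ i ] ∃[ j ] site i j ≡ z}
    ... | yes (i , j , _) = lookup (lookup g i) j
    ... | no  _           = blank

    paint-site : ∀ g i j → paint g (site i j) ≡ lookup (lookup g i) j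
    paint-site g i j with em {∃[ i′ ] ∃[ j′ ] site i′ j′ ≡ site i j}
    ... | no ∄ = contradiction (i , j , refl) ∄
    ... | yes (i′ , j′ , eq) with refl , refl ← disjoint {i′} {i} {j′} {j} eq = refl

    -- Surjectivity provides a preimage for every choice of patterns.
    preimage : Vec (Vec (Fin q) k) #tiles → Config d q
    preimage g = proj₁ (surj (paint g))

    global-preimage : ∀ g → global (preimage g) ≗ paint g
    global-preimage g = proj₂ (surj (paint g)) (λ _ → refl)

    -- The preimage seen from tile i.
    shifted : Vec (Vec (Fin q) k) #tiles → Fin #tiles → Config d q
    shifted g i z = preimage g (lookup tiles i ⊹ z)

    -- The restrictions of the preimage to the tiles and to the border.
    cut : Vec (Vec (Fin q) k) #tiles → Vec (Vec (Fin q) k) #tiles × Vec (Fin q) #border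
    cut g = Vec.tabulate (λ i → Vec.map (shifted g i) K) , Vec.map (preimage g) border

    cut-∈ : ∀ {g} → g ∈ power targets #tiles →
            cut g ∈ List.cartesianProduct (power sources #tiles) (allVecs q #border)
    cut-∈ {g} g∈ = ∈ˡ.∈-cartesianProduct⁺
      (∈-power⁺ _ (λ i → subst (_∈ sources) (sym (Vec.lookup∘tabulate _ i))
        (∈-sieve⁺ (∈-allVecs _) (is-source i))))
      (∈-allVecs _)
      where
      open ≡-Reasoning
      is-source : ∀ i → Source (extend K (Vec.map (shifted g i) K))
      is-source i = begin
        Vec.map (global (extend K (Vec.map (shifted g i) K))) D
          ≡⟨ global-local A D+V⊆K _ (shifted g i) (map-extend K! (Vec.map (shifted g i) K)) ⟩
        Vec.map (global (shifted g i)) D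
          ≡⟨ map-≡⁺ D agree ⟩
        Vec.map (extend K (lookup g i)) D
          ≡⟨ proj₂ (∈-sieve⁻ {xs = allVecs q k} (∈-power⁻ g∈ i)) ⟩
        w ∎
        where
        agree : ∀ {z} → z ∈ᵛ D → global (shifted g i) z ≡ extend K (lookup g i) z
        agree (l , refl) with j , eq ← D⊆K l = begin
          global (shifted g i) (lookup D l)
            ≡⟨ cong f (around-≡ V (shifted g i) (preimage g)
                 (λ v → cong (preimage g)
                          (sym (⊹-assoc (lookup tiles i) (lookup D l) (lookup V v))))) ⟩
          global (preimage g) (lookup tiles i ⊹ lookup D l)
            ≡⟨ global-preimage g _ ⟩
          paint g (lookup tiles i ⊹ lookup D l)
            ≡⟨ cong (λ z → paint g (lookup tiles i ⊹ z)) eq ⟨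
          paint g (site i j)
            ≡⟨ paint-site g i j ⟩
          lookup (lookup g i) j
            ≡⟨ override-lookup K! (lookup g i) _ j ⟨
          extend K (lookup g i) (lookup K j)
            ≡⟨ cong (extend K (lookup g i)) eq ⟩
          extend K (lookup g i) (lookup D l) ∎

    -- Tiles and border contain the neighbourhoods of all sites in tiles, so
    -- cut g determines the image of preimage g there, which is g.
    cut-injective : ∀ {g g′} → cut g ≡ cut g′ → g ≡ g′
    cut-injective {g} {g′} eq = lookup-≡⇒≡ λ i → lookup-≡⇒≡ λ j → begin
      lookup (lookup g i) j            ≡⟨ paint-site g i j ⟨
      paint g (site i j)               ≡⟨ global-preimage g (site i j) ⟨
      global (preimage g) (site i j)   ≡⟨ cong f (around-≡ V (preimage g) (preimage g′) (agree i j)) ⟩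
      global (preimage g′) (site i j)  ≡⟨ global-preimage g′ (site i j) ⟩
      paint g′ (site i j)              ≡⟨ paint-site g′ i j ⟩
      lookup (lookup g′ i) j           ∎
      where
      open ≡-Reasoning
      on-tiles : ∀ i j → preimage g (site i j) ≡ preimage g′ (site i j)
      on-tiles i j = map-≡⁻ {x = shifted g i} {shifted g′ i} K (begin
        Vec.map (shifted g i) K     ≡⟨ Vec.lookup∘tabulate _ i ⟨
        lookup (proj₁ (cut g)) i    ≡⟨ cong (λ c → lookup (proj₁ c) i) eq ⟩
        lookup (proj₁ (cut g′)) i   ≡⟨ Vec.lookup∘tabulate _ i ⟩
        Vec.map (shifted g′ i) K    ∎) (j , refl)
      agree : ∀ i j v → preimage g (site i j ⊹ lookup V v) ≡ preimage g′ (site i j ⊹ lookup V v)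
      agree i j v with closed i j v
      ... | inj₂ z∈border = map-≡⁻ border (cong proj₂ eq) z∈border
      ... | inj₁ (i′ , j′ , eq′) = begin
        preimage g (site i j ⊹ lookup V v)    ≡⟨ cong (preimage g) eq′ ⟨
        preimage g (site i′ j′)               ≡⟨ on-tiles i′ j′ ⟩
        preimage g′ (site i′ j′)              ≡⟨ cong (preimage g′) eq′ ⟩
        preimage g′ (site i j ⊹ lookup V v)   ∎

    targets≤sources : List.length targets ^ #tiles ≤ List.length sources ^ #tiles * q ^ #border
    targets≤sources = begin
      List.length targets ^ #tiles
        ≡⟨ length-power targets #tiles ⟨
      List.length (power targets #tiles)
        ≤⟨ injection⇒length≤ cut
             (power-unique (Unique.filter⁺ (λ _ → em) (allVecs-unique q k)) #tiles)
             cut-∈ (λ _ _ → cut-injective) ⟩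
      List.length (List.cartesianProduct (power sources #tiles) (allVecs q #border))
        ≡⟨ length-cartesianProductWith _,_ (power sources #tiles) (allVecs q #border) ⟩
      List.length (power sources #tiles) * List.length (allVecs q #border)
        ≡⟨ cong₂ _*_ (length-power sources #tiles) (length-allVecs q #border) ⟩
      List.length sources ^ #tiles * q ^ #border ∎
      where open ℕ.≤-Reasoning

  1≤q : ∀ {m} → Fin m → 1 ≤ m
  1≤q {suc _} _ = s≤s z≤n

  patterns-preimage-≥ : (∀ C → 1 ≤ C → Tiling V K C) → patterns K Target ≤ patterns K Source
  patterns-preimage-≥ tiling = subst₂ _≤_
    (length-sieve (Target ∘ extend K) (allVecs q k))
    (length-sieve (Source ∘ extend K) (allVecs q k))
    (ℕ.≮⇒≥ λ few-sources →
      let t = tiling (List.length targets * q)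
                (ℕ.*-mono-≤ (ℕ.≤-trans (s≤s z≤n) few-sources) (1≤q blank)) in
      tiles-beat-border few-sources (1≤q blank) (Tiling.many t) (Tiling.few t) (targets≤sources t))

-- Tilings by boxes

-- The maximum norm.
norm : ∀ {d} → Site d → ℕ
norm []      = 0
norm (c ∷ z) = ℤ.∣ c ∣ ⊔ norm z

coordinate≤norm : ∀ {d} (z : Site d) i → ℤ.∣ lookup z i ∣ ≤ norm z
coordinate≤norm (c ∷ z) zero    = ℕ.m≤m⊔n ℤ.∣ c ∣ (norm z)
coordinate≤norm (c ∷ z) (suc i) = ℕ.≤-trans (coordinate≤norm z i) (ℕ.m≤n⊔m ℤ.∣ c ∣ (norm z))

-- The largest norm of the sites in a window.
radius : ∀ {d n} → Vec (Site d) n → ℕ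
radius []       = 0
radius (z ∷ zs) = norm z ⊔ radius zs

norm≤radius : ∀ {d n} (zs : Vec (Site d) n) i → norm (lookup zs i) ≤ radius zs
norm≤radius (z ∷ zs) zero    = ℕ.m≤m⊔n (norm z) (radius zs)
norm≤radius (z ∷ zs) (suc i) = ℕ.≤-trans (norm≤radius zs i) (ℕ.m≤n⊔m (norm z) (radius zs))

private module ℤ+ = Algebra.Properties.Group (AbelianGroup.group ℤ.+-0-abelianGroup)

-- The integers lo, lo + 1, ..., lo + (n - 1).
interval : ℤ → ℕ → List ℤ
interval lo n = List.map (λ i → lo ℤ.+ ℤ.+ i) (List.upTo n)

length-interval : ∀ lo n → List.length (interval lo n) ≡ n
length-interval lo n = trans (List.length-map _ (List.upTo n)) (List.length-upTo n)

∈-interval⁺ : ∀ lo n {i x} → i < n → x ≡ lo ℤ.+ ℤ.+ i → x ∈ interval lo n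
∈-interval⁺ lo n i<n refl = ∈ˡ.∈-map⁺ _ (∈ˡ.∈-upTo⁺ i<n)

∈-interval⁻ : ∀ lo n {x} → x ∈ interval lo n → ∃[ i ] (i < n × x ≡ lo ℤ.+ ℤ.+ i)
∈-interval⁻ lo n x∈ with i , i∈ , refl ← ∈ˡ.∈-map⁻ _ x∈ = i , ∈ˡ.∈-upTo⁻ i∈ , refl

interval-unique : ∀ lo n → Unique (interval lo n)
interval-unique lo n = Unique.map⁺ (λ {i} {j} eq →
  ℤ.+-injective (ℤ+.∙-cancelˡ lo (ℤ.+ i) (ℤ.+ j) eq)) (Unique.upTo⁺ n)

-- In each coordinate, m translates of [-r , r] cover [-r , m (2 r + 1) - r),
-- and adding numbers of absolute value at most r to it leads into
-- [-2 r , m (2 r + 1)).  The collar is the difference of the two intervals.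
module Box (r m : ℕ) where

  -- The lengths of the intervals [-r , r] and [-2 r , m (2 r + 1)).

  L E : ℕ
  L = suc (r + r)
  E = m * L + (r + r)

  -r : ℤ
  -r = ℤ.- (ℤ.+ r)

  cell offsets reach collar : List ℤ
  cell    = interval -r L
  offsets = List.map (λ t → ℤ.+ (t * L)) (List.upTo m)
  reach   = interval (-r ℤ.+ -r) E
  collar  = interval (-r ℤ.+ -r) r List.++ interval (-r ℤ.+ ℤ.+ (m * L)) r

  length-offsets : List.length offsets ≡ m
  length-offsets = trans (List.length-map _ (List.upTo m)) (List.length-upTo m)

  length-collar : List.length collar ≡ r + r
  length-collar = trans (List.length-++ (interval (-r ℤ.+ -r) r))
    (cong₂ _+_ (length-interval (-r ℤ.+ -r) r) (length-interval (-r ℤ.+ ℤ.+ (m * L)) r))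

  offsets-unique : Unique offsets
  offsets-unique = Unique.map⁺ (λ {i} {j} eq → ℕ.*-cancelʳ-≡ i j L (ℤ.+-injective eq)) (Unique.upTo⁺ m)

  ∈-offsets⁻ : ∀ {x} → x ∈ offsets → ∃[ t ] (t < m × x ≡ ℤ.+ (t * L))
  ∈-offsets⁻ x∈ with t , t∈ , refl ← ∈ˡ.∈-map⁻ _ x∈ = t , ∈ˡ.∈-upTo⁻ t∈ , refl

  ∣x∣≤r⇒∈cell : ∀ {x} → ℤ.∣ x ∣ ≤ r → x ∈ cell
  ∣x∣≤r⇒∈cell {ℤ.+ n} n≤r = ∈-interval⁺ -r L (s≤s (ℕ.+-monoʳ-≤ r n≤r)) (begin
    ℤ.+ n                           ≡⟨ ℤ.+-identityˡ (ℤ.+ n) ⟨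
    ℤ.0ℤ ℤ.+ ℤ.+ n                  ≡⟨ cong (ℤ._+ ℤ.+ n) (ℤ.+-inverseˡ (ℤ.+ r)) ⟨
    (-r ℤ.+ ℤ.+ r) ℤ.+ ℤ.+ n        ≡⟨ ℤ.+-assoc -r (ℤ.+ r) (ℤ.+ n) ⟩
    -r ℤ.+ ℤ.+ (r + n)              ∎)
    where open ≡-Reasoning
  ∣x∣≤r⇒∈cell { -[1+ n ]} n<r = ∈-interval⁺ -r L
    (s≤s (ℕ.≤-trans (ℕ.m∸n≤m r (suc n)) (ℕ.m≤m+n r r))) (begin
    -[1+ n ]                                    ≡⟨ ℤ.+-identityˡ -[1+ n ] ⟨
    ℤ.0ℤ ℤ.+ -[1+ n ]                           ≡⟨ cong (ℤ._+ -[1+ n ]) (ℤ.+-inverseˡ (ℤ.+ r)) ⟨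
    (-r ℤ.+ ℤ.+ r) ℤ.+ -[1+ n ]                 ≡⟨ ℤ.+-assoc -r (ℤ.+ r) -[1+ n ] ⟩
    -r ℤ.+ (r ℤ.⊖ suc n)                        ≡⟨ cong (λ x → -r ℤ.+ x) (ℤ.⊖-≥ n<r) ⟩
    -r ℤ.+ ℤ.+ (r ∸ suc n)                      ∎)
    where open ≡-Reasoning

  ∈cell⇒∣x∣≤r : ∀ {x} → x ∈ cell → ℤ.∣ x ∣ ≤ r
  ∈cell⇒∣x∣≤r x∈ with i , s≤s i≤2r , refl ← ∈-interval⁻ -r L x∈
    rewrite ℤ.-m+n≡n⊖m r i with ℕ.≤-total i r
  ... | inj₁ i≤r = subst (_≤ r) (sym (ℤ.∣⊖∣-≤ i≤r)) (ℕ.m∸n≤m r i)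
  ... | inj₂ r≤i = subst (_≤ r) (sym (cong ℤ.∣_∣ (ℤ.⊖-≥ r≤i)))
    (ℕ.m≤n+o⇒m∸n≤o i r i≤2r)

  cell-disjoint : ∀ {s s′ k k′} → s ∈ offsets → s′ ∈ offsets → k ∈ cell → k′ ∈ cell →
                  s ℤ.+ k ≡ s′ ℤ.+ k′ → s ≡ s′ × k ≡ k′
  cell-disjoint s∈ s′∈ k∈ k′∈ eq
    with t  , _ , refl ← ∈-offsets⁻ s∈  | t′ , _ , refl ← ∈-offsets⁻ s′∈
       | i  , i<L  , refl ← ∈-interval⁻ -r L k∈ | i′ , i′<L , refl ← ∈-interval⁻ -r L k′∈ =
    cong (λ t → ℤ.+ (t * L)) t≡t′ , cong (λ i → -r ℤ.+ ℤ.+ i) i≡i′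
    where
    open ≡-Reasoning
    open import Data.Nat.DivMod using (_%_; [m+kn]%n≡m%n; m<n⇒m%n≡m)
    swap-out : ∀ t i → ℤ.+ (t * L) ℤ.+ (-r ℤ.+ ℤ.+ i) ≡ -r ℤ.+ ℤ.+ (i + t * L)
    swap-out t i = solve 3 (λ a b c → a :+ (b :+ c) := b :+ (c :+ a)) refl (ℤ.+ (t * L)) -r (ℤ.+ i)
      where open ℤ.+-*-Solver
    eqℕ : i + t * L ≡ i′ + t′ * L
    eqℕ = ℤ.+-injective (ℤ+.∙-cancelˡ -r _ _ (trans (sym (swap-out t i)) (trans eq (swap-out t′ i′))))
    i≡i′ : i ≡ i′
    i≡i′ = begin
      i                  ≡⟨ m<n⇒m%n≡m i<L ⟨
      i % L              ≡⟨ [m+kn]%n≡m%n i t L ⟨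
      (i + t * L) % L    ≡⟨ cong (_% L) eqℕ ⟩
      (i′ + t′ * L) % L  ≡⟨ [m+kn]%n≡m%n i′ t′ L ⟩
      i′ % L             ≡⟨ m<n⇒m%n≡m i′<L ⟩
      i′                 ∎
    t≡t′ : t ≡ t′
    t≡t′ = ℕ.*-cancelʳ-≡ t t′ L (ℕ.+-cancelˡ-≡ i (t * L) (t′ * L)
      (trans eqℕ (cong (_+ t′ * L) (sym i≡i′))))

  +-∈reach : ∀ {s k x} → s ∈ offsets → k ∈ cell → ℤ.∣ x ∣ ≤ r → (s ℤ.+ k) ℤ.+ x ∈ reach
  +-∈reach {x = x} s∈ k∈ ∣x∣≤r
    with t , t<m , refl ← ∈-offsets⁻ s∈
       | i , i<L , refl ← ∈-interval⁻ -r L k∈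
       | j , s≤s j≤2r , refl ← ∈-interval⁻ -r L (∣x∣≤r⇒∈cell {x} ∣x∣≤r) =
    ∈-interval⁺ (-r ℤ.+ -r) E bound
      (solve 4 (λ a b c e → (a :+ (b :+ c)) :+ (b :+ e) := (b :+ b) :+ ((c :+ a) :+ e)) refl
        (ℤ.+ (t * L)) -r (ℤ.+ i) (ℤ.+ j))
    where
    open ℤ.+-*-Solver
    open ℕ.≤-Reasoning
    bound : (i + t * L) + j < E
    bound = begin-strict
      (i + t * L) + j  <⟨ ℕ.+-monoˡ-< j (ℕ.+-monoˡ-< (t * L) i<L) ⟩
      suc t * L + j    ≤⟨ ℕ.+-mono-≤ (ℕ.*-monoˡ-≤ L t<m) j≤2r ⟩
      E                ∎

  -- Division by L finds the translate.
  reach-split : ∀ {x} → x ∈ reach →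
    (∃[ s ] ∃[ k ] (s ∈ offsets × k ∈ cell × s ℤ.+ k ≡ x)) ⊎ x ∈ collar
  reach-split x∈ with ∈-interval⁻ (-r ℤ.+ -r) E x∈
  ... | e , e<E , refl with e <? r
  ... | yes e<r = inj₂ (∈ˡ.∈-++⁺ˡ (∈-interval⁺ (-r ℤ.+ -r) r e<r refl))
  ... | no  e≮r with ℕ.m≤n⇒∃[o]m+o≡n (ℕ.≮⇒≥ e≮r)
  ... | e′ , refl with e′ <? m * L
  ... | yes e′<mL = inj₁
    ( ℤ.+ (e′ / L * L) , -r ℤ.+ ℤ.+ (e′ % L)
    , ∈ˡ.∈-map⁺ _ (∈ˡ.∈-upTo⁺ (m<n*o⇒m/o<n e′<mL))
    , ∈-interval⁺ -r L (m%n<n e′ L) refl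
    , (begin
        ℤ.+ (e′ / L * L) ℤ.+ (-r ℤ.+ ℤ.+ (e′ % L))
          ≡⟨ solve 3 (λ a b c → a :+ (:- b :+ c) := (:- b :+ :- b) :+ (b :+ (c :+ a))) refl
               (ℤ.+ (e′ / L * L)) (ℤ.+ r) (ℤ.+ (e′ % L)) ⟩
        (-r ℤ.+ -r) ℤ.+ ℤ.+ (r + (e′ % L + e′ / L * L))
          ≡⟨ cong (λ i → (-r ℤ.+ -r) ℤ.+ ℤ.+ (r + i)) (m≡m%n+[m/n]*n e′ L) ⟨
        (-r ℤ.+ -r) ℤ.+ ℤ.+ (r + e′) ∎))
    where
    open ≡-Reasoning
    open import Data.Nat.DivMod using (_/_; _%_; m<n*o⇒m/o<n; m%n<n; m≡m%n+[m/n]*n)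
    open ℤ.+-*-Solver
  ... | no e′≮mL with ℕ.m≤n⇒∃[o]m+o≡n (ℕ.≮⇒≥ e′≮mL)
  ... | e″ , refl = inj₂ (∈ˡ.∈-++⁺ʳ (interval (-r ℤ.+ -r) r) (∈-interval⁺ (-r ℤ.+ ℤ.+ (m * L)) r e″<r
    (solve 3 (λ b c e → (:- b :+ :- b) :+ (b :+ (c :+ e)) := (:- b :+ c) :+ e) refl
      (ℤ.+ r) (ℤ.+ (m * L)) (ℤ.+ e″))))
    where
    open ℤ.+-*-Solver
    e″<r : e″ < r
    e″<r = ℕ.+-cancelˡ-< (r + m * L) e″ r (subst₂ _<_
      (sym (ℕ.+-assoc r (m * L) e″))
      (trans (sym (ℕ.+-assoc (m * L) r r)) (cong (_+ r) (ℕ.+-comm (m * L) r))) e<E)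

  -- The sites that have all coordinates in reach and at least one in the collar.
  frame : ∀ d → List (Site d)
  frame zero    = []
  frame (suc d) = List.cartesianProductWith _∷_ collar (power reach d) List.++
                  List.cartesianProductWith _∷_ reach (frame d)

  -- One factor per coordinate that may lie in the collar: of order m ^ d in
  -- dimension d + 1.
  length-frame : ∀ d → List.length (frame (suc d)) ≡ suc d * ((r + r) * E ^ d)
  length-frame d = begin
    List.length (frame (suc d))
      ≡⟨ List.length-++ (List.cartesianProductWith _∷_ collar (power reach d)) ⟩
    List.length (List.cartesianProductWith _∷_ collar (power reach d)) +
    List.length (List.cartesianProductWith _∷_ reach (frame d))
      ≡⟨ cong₂ _+_ (length-cartesianProductWith _∷_ collar (power reach d))
                   (length-cartesianProductWith _∷_ reach (frame d)) ⟩
    List.length collar * List.length (power reach d) + List.length reach * List.length (frame d)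
      ≡⟨ cong₂ _+_
           (cong₂ _*_ length-collar (trans (length-power reach d) (cong (_^ d) length-reach)))
           (cong (_* List.length (frame d)) length-reach) ⟩
    (r + r) * E ^ d + E * List.length (frame d)
      ≡⟨ cong ((r + r) * E ^ d +_) (step d) ⟩
    suc d * ((r + r) * E ^ d) ∎
    where
    open ≡-Reasoning
    length-reach : List.length reach ≡ E
    length-reach = length-interval (-r ℤ.+ -r) E
    step : ∀ d → E * List.length (frame d) ≡ d * ((r + r) * E ^ d)
    step zero    = ℕ.*-zeroʳ E
    step (suc d) = trans (cong (E *_) (length-frame d))
      (solve 4 (λ e n s p → e :* (n :* (s :* p)) := n :* (s :* (e :* p))) refl
        E (suc d) (r + r) (E ^ d))
      where open ℕ.+-*-Solver

  split : ∀ {d} (z : Site d) → (∀ i → lookup z i ∈ reach) →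
    (∃[ s ] ∃[ k ] (s ∈ power offsets d × k ∈ power cell d × s ⊹ k ≡ z)) ⊎ z ∈ frame d
  split []      _  = inj₁ ([] , [] , here refl , here refl , refl)
  split {suc d} (c ∷ z) z∈ with reach-split (z∈ zero) | split z (z∈ ∘ suc)
  ... | inj₂ c∈ | _ = inj₂ (∈ˡ.∈-++⁺ˡ (∈ˡ.∈-cartesianProductWith⁺ _∷_ c∈ (∈-power⁺ z (z∈ ∘ suc))))
  ... | inj₁ _  | inj₂ z∈frame = inj₂ (∈ˡ.∈-++⁺ʳ (List.cartesianProductWith _∷_ collar (power reach d))
    (∈ˡ.∈-cartesianProductWith⁺ _∷_ (z∈ zero) z∈frame))
  ... | inj₁ (t , i , t∈ , i∈ , eq) | inj₁ (s , k , s∈ , k∈ , eqs) = inj₁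
    ( t ∷ s , i ∷ k
    , ∈ˡ.∈-cartesianProductWith⁺ _∷_ t∈ s∈ , ∈ˡ.∈-cartesianProductWith⁺ _∷_ i∈ k∈
    , cong₂ _∷_ eq eqs )

norm-lub : ∀ {d n} (z : Site d) → (∀ i → ℤ.∣ lookup z i ∣ ≤ n) → norm z ≤ n
norm-lub []      _   = z≤n
norm-lub (c ∷ z) bd = ℕ.⊔-lub (bd zero) (norm-lub z (bd ∘ suc))

opaque
  -- The box with the coordinates in [-r , r]; opaque, so that its list of
  -- sites is not unfolded.  The cell does not depend on the number of
  -- translates, which is set to 0.
  box : ∀ d → ℕ → Window d
  box d r = record
    { sites = Vec.fromList (power (Box.cell r 0) d)
    ; distinct = fromList-unique (power-unique (interval-unique (Box.-r r 0) (Box.L r 0)) d) }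

  norm≤⇒∈box : ∀ {d r} (z : Site d) → norm z ≤ r → z ∈ᵛ sites (box d r)
  norm≤⇒∈box {r = r} z z≤r = ∈-fromList⁺ (∈-power⁺ z λ i →
    Box.∣x∣≤r⇒∈cell r 0 (ℕ.≤-trans (coordinate≤norm z i) z≤r))

  norm-box : ∀ d r i → norm (lookup (sites (box d r)) i) ≤ r
  norm-box d r i = norm-lub (lookup (sites (box d r)) i) λ j → Box.∈cell⇒∣x∣≤r r 0
    (∈-power⁻ (∈-fromList⁻ (power (Box.cell r 0) d) i) j)

box-mono : ∀ {d m n} → m ≤ n → sites (box d m) ⊆ᵛ sites (box d n)
box-mono {d} {m} m≤n i = norm≤⇒∈box (lookup (sites (box d m)) i) (ℕ.≤-trans (norm-box d m i) m≤n)

radius-lub : ∀ {d n k} (K : Vec (Site d) k) → (∀ i → norm (lookup K i) ≤ n) → radius K ≤ n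
radius-lub []      _   = z≤n
radius-lub (z ∷ K) K≤n = ℕ.⊔-lub (K≤n zero) (radius-lub K (K≤n ∘ suc))

lookup-⊹ : ∀ {d} (y z : Site d) i → lookup (y ⊹ z) i ≡ lookup y i ℤ.+ lookup z i
lookup-⊹ y z i = Vec.lookup-zipWith ℤ._+_ i y z

opaque
  unfolding box

  box-tiling : ∀ {d r ρ} (V : Vec (Site (suc d)) ρ) → (∀ j → norm (lookup V j) ≤ r) →
               ∀ C → 1 ≤ C → Tiling V (sites (box (suc d) r)) C
  box-tiling {d} {r} V V≤r C 1≤C = record
    { factor   = suc c * m ^ d
    ; tiles    = Vec.fromList (power offsets (suc d))
    ; border   = Vec.fromList (frame (suc d))
    ; disjoint = λ {i} {i′} {j} {j′} eq →
        let s≡s′ , k≡k′ = disjoint (tile∈ i) (tile∈ i′) (site∈ j) (site∈ j′) eq in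
        Vec.lookup-injective (fromList-unique (power-unique offsets-unique (suc d))) i i′ s≡s′ ,
        Vec.lookup-injective (distinct (box (suc d) r)) j j′ k≡k′
    ; closed   = closed
    ; many     = begin-equality
        List.length (power offsets (suc d)) ≡⟨ length-power offsets (suc d) ⟩
        List.length offsets ^ suc d         ≡⟨ cong (_^ suc d) length-offsets ⟩
        C * suc c * m ^ d                   ≡⟨ ℕ.*-assoc C (suc c) (m ^ d) ⟩
        C * (suc c * m ^ d)                 ∎
    ; few      = begin-strict
        List.length (frame (suc d))                   ≡⟨ length-frame d ⟩
        suc d * ((r + r) * E ^ d)
          ≤⟨ ℕ.*-monoʳ-≤ (suc d) (ℕ.*-monoʳ-≤ (r + r) (ℕ.^-monoˡ-≤ d E≤)) ⟩
        suc d * ((r + r) * (m * (L + (r + r))) ^ d)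
          ≡⟨ cong (λ p → suc d * ((r + r) * p)) (^-distribʳ-* d m (L + (r + r))) ⟩
        suc d * ((r + r) * (m ^ d * (L + (r + r)) ^ d))
          ≡⟨ solve 4 (λ n s p l → n :* (s :* (p :* l)) := n :* (s :* l) :* p) refl
               (suc d) (r + r) (m ^ d) ((L + (r + r)) ^ d) ⟩
        c * m ^ d
          <⟨ ℕ.m<n+m (c * m ^ d) (ℕ.m^n>0 m ⦃ >-nonZero 1≤m ⦄ d) ⟩
        suc c * m ^ d                                 ∎
    }
    where
    open ℕ.≤-Reasoning
    open ℕ.+-*-Solver
    -- The frame has at most c m ^ d sites, the tiling m ^ (d + 1) tiles.
    c m : ℕ
    c = suc d * ((r + r) * (suc (r + r) + (r + r)) ^ d)
    m = C * suc c
    open Box r m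
    1≤m : 1 ≤ m
    1≤m = ℕ.*-mono-≤ 1≤C (s≤s z≤n)
    E≤ : E ≤ m * (L + (r + r))
    E≤ = begin
      m * L + (r + r)         ≤⟨ ℕ.+-monoʳ-≤ (m * L) (ℕ.m≤n*m (r + r) m ⦃ >-nonZero 1≤m ⦄) ⟩
      m * L + m * (r + r)     ≡⟨ ℕ.*-distribˡ-+ m L (r + r) ⟨
      m * (L + (r + r))       ∎
    tile∈ : ∀ i → lookup (Vec.fromList (power offsets (suc d))) i ∈ power offsets (suc d)
    tile∈ = ∈-fromList⁻ (power offsets (suc d))
    site∈ : ∀ j → lookup (sites (box (suc d) r)) j ∈ power cell (suc d)
    site∈ = ∈-fromList⁻ (power cell (suc d))
    disjoint : ∀ {s s′ k k′} → s ∈ power offsets (suc d) → s′ ∈ power offsets (suc d) →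
               k ∈ power cell (suc d) → k′ ∈ power cell (suc d) →
               s ⊹ k ≡ s′ ⊹ k′ → s ≡ s′ × k ≡ k′
    disjoint {s} {s′} {k} {k′} s∈ s′∈ k∈ k′∈ eq =
      lookup-≡⇒≡ (proj₁ ∘ pointwise) , lookup-≡⇒≡ (proj₂ ∘ pointwise)
      where
      pointwise : ∀ i → lookup s i ≡ lookup s′ i × lookup k i ≡ lookup k′ i
      pointwise i = cell-disjoint (∈-power⁻ s∈ i) (∈-power⁻ s′∈ i) (∈-power⁻ k∈ i) (∈-power⁻ k′∈ i)
        (trans (sym (lookup-⊹ s k i)) (trans (cong (λ z → lookup z i) eq) (lookup-⊹ s′ k′ i)))
    closed : ∀ i j v →
      let tiles = Vec.fromList (power offsets (suc d)) ; K = sites (box (suc d) r)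
          z = (lookup tiles i ⊹ lookup K j) ⊹ lookup V v in
      (∃[ i′ ] ∃[ j′ ] lookup tiles i′ ⊹ lookup K j′ ≡ z) ⊎ z ∈ᵛ Vec.fromList (frame (suc d))
    closed i j v with split _ in-reach
      where
      tile site : Site (suc d)
      tile = lookup (Vec.fromList (power offsets (suc d))) i
      site = lookup (sites (box (suc d) r)) j
      in-reach : ∀ l → lookup ((tile ⊹ site) ⊹ lookup V v) l ∈ reach
      in-reach l = subst (_∈ reach)
        (sym (trans (lookup-⊹ (tile ⊹ site) (lookup V v) l)
          (cong (ℤ._+ lookup (lookup V v) l) (lookup-⊹ tile site l))))
        (+-∈reach (∈-power⁻ (tile∈ i) l) (∈-power⁻ (site∈ j) l)
          (ℕ.≤-trans (coordinate≤norm (lookup V v) l) (V≤r v)))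
    ... | inj₂ z∈frame = inj₂ (∈-fromList⁺ z∈frame)
    ... | inj₁ (s , k , s∈ , k∈ , eq)
      with i′ , refl ← ∈-fromList⁺ s∈ | j′ , refl ← ∈-fromList⁺ k∈ = inj₁ (i′ , j′ , eq)

-- Weights of cylinders as relative frequencies of patterns

/-cross : ∀ {m n m′ n′} ⦃ _ : NonZero n ⦄ ⦃ _ : NonZero n′ ⦄ → m * n′ ≡ m′ * n →
          ℤ.+ m ℚ./ n ≡ ℤ.+ m′ ℚ./ n′
/-cross {m} {suc n} {m′} {suc n′} eq = ℚ.fromℚᵘ-cong {ℚᵘ.mkℚᵘ (ℤ.+ m) n} {ℚᵘ.mkℚᵘ (ℤ.+ m′) n′}
  (ℚᵘ.*≡* (trans (sym (ℤ.pos-* m (suc n′))) (trans (cong (λ i → ℤ.+ i) eq) (ℤ.pos-* m′ (suc n)))))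

/-+ : ∀ m n k ⦃ _ : NonZero k ⦄ → ℤ.+ m ℚ./ k ℚ.+ ℤ.+ n ℚ./ k ≡ ℤ.+ (m + n) ℚ./ k
/-+ m n (suc k) = ℚ.toℚᵘ-injective (begin
  ℚ.toℚᵘ (ℤ.+ m ℚ./ suc k ℚ.+ ℤ.+ n ℚ./ suc k)
    ≈⟨ ℚ.toℚᵘ-homo-+ (ℤ.+ m ℚ./ suc k) (ℤ.+ n ℚ./ suc k) ⟩
  ℚ.toℚᵘ (ℤ.+ m ℚ./ suc k) ℚᵘ.+ ℚ.toℚᵘ (ℤ.+ n ℚ./ suc k)
    ≈⟨ ℚᵘ.+-cong (ℚ.toℚᵘ-fromℚᵘ (ℚᵘ.mkℚᵘ (ℤ.+ m) k)) (ℚ.toℚᵘ-fromℚᵘ (ℚᵘ.mkℚᵘ (ℤ.+ n) k)) ⟩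
  ℚᵘ.mkℚᵘ (ℤ.+ m) k ℚᵘ.+ ℚᵘ.mkℚᵘ (ℤ.+ n) k
    ≈⟨ ℚᵘ.*≡* (solve 3 (λ a b c → (a :* c :+ b :* c) :* c := (a :+ b) :* (c :* c)) refl
         (ℤ.+ m) (ℤ.+ n) (ℤ.+ suc k)) ⟩
  ℚᵘ.mkℚᵘ (ℤ.+ (m + n)) k
    ≈⟨ ℚ.toℚᵘ-fromℚᵘ (ℚᵘ.mkℚᵘ (ℤ.+ (m + n)) k) ⟨
  ℚ.toℚᵘ (ℤ.+ (m + n) ℚ./ suc k) ∎)
  where
  open import Relation.Binary.Reasoning.Setoid ℚᵘ.≃-setoid
  open ℤ.+-*-Solver

/-mono : ∀ {m n} k ⦃ _ : NonZero k ⦄ → m ≤ n → ℤ.+ m ℚ./ k ℚ.≤ ℤ.+ n ℚ./ k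
/-mono {m} {n} (suc k) m≤n = ℚ.toℚᵘ-cancel-≤ (begin
  ℚ.toℚᵘ (ℤ.+ m ℚ./ suc k)  ≃⟨ ℚ.toℚᵘ-fromℚᵘ (ℚᵘ.mkℚᵘ (ℤ.+ m) k) ⟩
  ℚᵘ.mkℚᵘ (ℤ.+ m) k         ≤⟨ ℚᵘ.*≤* (ℤ.*-monoʳ-≤-nonNeg (ℤ.+ suc k) (ℤ.+≤+ m≤n)) ⟩
  ℚᵘ.mkℚᵘ (ℤ.+ n) k         ≃⟨ ℚ.toℚᵘ-fromℚᵘ (ℚᵘ.mkℚᵘ (ℤ.+ n) k) ⟨
  ℚ.toℚᵘ (ℤ.+ n ℚ./ suc k)  ∎)
  where open ℚᵘ.≤-Reasoning

0/-≡0 : ∀ k ⦃ _ : NonZero k ⦄ → ℤ.+ 0 ℚ./ k ≡ 0ℚ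
0/-≡0 k = /-cross {0} {k} {0} {1} refl

-- Termwise φ ≤ ψ is an equality if the sum of ψ is at most that of φ.
∑-tight : ∀ {A : Set} (xs : List A) {φ ψ} → (∀ x → φ x ≤ ψ x) → ∑ xs ψ ≤ ∑ xs φ →
          ∀ {x} → x ∈ xs → ψ x ≤ φ x
∑-tight (x ∷ xs) {φ} {ψ} φ≤ψ tight (here refl) = ℕ.+-cancelʳ-≤ (∑ xs ψ) (ψ x) (φ x)
  (ℕ.≤-trans tight (ℕ.+-monoʳ-≤ (φ x) (∑-mono xs φ≤ψ)))
∑-tight (x ∷ xs) {φ} {ψ} φ≤ψ tight (there x∈) = ∑-tight xs φ≤ψ
  (ℕ.+-cancelˡ-≤ (ψ x) (∑ xs ψ) (∑ xs φ) (ℕ.≤-trans tight (ℕ.+-monoˡ-≤ (∑ xs φ) (φ≤ψ x)))) x∈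

norm-⊹ : ∀ {d} (y z : Site d) → norm (y ⊹ z) ≤ norm y + norm z
norm-⊹ []      []      = z≤n
norm-⊹ (b ∷ y) (c ∷ z) = ℕ.⊔-lub
  (ℕ.≤-trans (ℤ.∣i+j∣≤∣i∣+∣j∣ b c)
    (ℕ.+-mono-≤ (ℕ.m≤m⊔n ℤ.∣ b ∣ (norm y)) (ℕ.m≤m⊔n ℤ.∣ c ∣ (norm z))))
  (ℕ.≤-trans (norm-⊹ y z)
    (ℕ.+-mono-≤ (ℕ.m≤n⊔m ℤ.∣ b ∣ (norm y)) (ℕ.m≤n⊔m ℤ.∣ c ∣ (norm z))))

⊆-box : ∀ {d r n} (D : Vec (Site d) n) → radius D ≤ r → D ⊆ᵛ sites (box d r)
⊆-box D D≤r i = norm≤⇒∈box (lookup D i) (ℕ.≤-trans (norm≤radius D i) D≤r)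

neighbourhood⊆-box : ∀ {d r n ρ} (V : Vec (Site d) ρ) (D : Vec (Site d) n) →
                     radius D + radius V ≤ r → Neighbourhood⊆ V D (sites (box d r))
neighbourhood⊆-box V D D+V≤r i j = norm≤⇒∈box (lookup D i ⊹ lookup V j) (ℕ.≤-trans
  (norm-⊹ (lookup D i) (lookup V j))
  (ℕ.≤-trans (ℕ.+-mono-≤ (norm≤radius D i) (norm≤radius V j)) D+V≤r))

open Cylinder using (symbols) renaming (sites to support; distinct to support-unique)

-- On a box large enough to contain the neighbourhood of its support,
-- a cylinder and its preimage hold equally many patterns.
module Balanced (em : ExcludedMiddle 0ℓ) {d} (A : ClassicalCA (suc d)) (surj : Surjective A)
  (blank : Fin (ClassicalCA.#Q A)) where

  open ClassicalCA A using (V; global) renaming (#Q to q)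
  open Patterns em {suc d} blank

  patterns-preimage : ∀ {r} (u : Cylinder (suc d) q) → radius (support u) + radius V ≤ r →
    let K = sites (box (suc d) r) in patterns K (⟦ u ⟧ᶜ ∘ global) ≡ patterns K ⟦ u ⟧ᶜ
  patterns-preimage {r} u D+V≤r = ℕ.≤-antisym
    (∑-tight (allVecs q _) at-least (ℕ.≤-reflexive (trans
      (∑-patterns K! (λ x → Vec.map (global x) D))
      (sym (∑-patterns K! (λ x → Vec.map x D)))))
      (∈-allVecs (symbols u)))
    (at-least (symbols u))
    where
    D = support u
    K = sites (box (suc d) r)
    K! = distinct (box (suc d) r)
    at-least : ∀ w →
      patterns K (λ x → Vec.map x D ≡ w) ≤ patterns K (λ x → Vec.map (global x) D ≡ w)
    at-least w = Balance.patterns-preimage-≥ em A surj blank (support-unique u) w K!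
      (⊆-box D (ℕ.m+n≤o⇒m≤o (radius D) D+V≤r)) (neighbourhood⊆-box V D D+V≤r)
      (box-tiling V (λ j → ℕ.≤-trans (norm≤radius V j) (ℕ.m+n≤o⇒n≤o (radius D) D+V≤r)))

-- Compactness

upper-bound : ∀ {n} (g : Fin n → ℕ) → ∃[ N ] (∀ i → g i ≤ N)
upper-bound {zero}  g = 0 , λ ()
upper-bound {suc n} g = let N , g≤N = upper-bound (g ∘ suc) in
  g zero ⊔ N , λ { zero    → ℕ.m≤m⊔n (g zero) N
                 ; (suc i) → ℕ.≤-trans (g≤N i) (ℕ.m≤n⊔m (g zero) N) }

-- Membership in P depends only on the symbols on a finite window.
Local : ∀ {d q} → Pred (Config d q) 0ℓ → Set
Local {d} P = ∃[ k ] Σ (Vec (Site d) k) λ K → ∀ {x y} → Vec.map x K ≡ Vec.map y K → P x → P y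

module Compactness (em : ExcludedMiddle 0ℓ) {d q : ℕ} where

  ¬∀⇒∃¬ : ∀ {A : Set} {P : A → Set} → ¬ (∀ a → P a) → ∃[ a ] ¬ P a
  ¬∀⇒∃¬ {P = P} ¬∀ with em {∃[ a ] ¬ P a}
  ... | yes ∃¬ = ∃¬
  ... | no ∄¬  = contradiction all ¬∀
    where
    all : ∀ a → P a
    all a with em {P a}
    ... | yes p = p
    ... | no ¬p = contradiction (a , ¬p) ∄¬

  module _ (C : ℕ → Pred (Config d q) 0ℓ) (local : ∀ n → Local (C n))
           (decreasing : ∀ {n x} → C (suc n) x → C n x) (inhabited : ∀ n → ∃[ x ] C n x) where

    decreasing-≤ : ∀ {m n x} → m ≤ n → C n x → C m x
    decreasing-≤ {m} {n} m≤n = go (ℕ.≤⇒≤′ m≤n)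
      where
      go : ∀ {n x} → m ≤′ n → C n x → C m x
      go (≤′-reflexive refl) c = c
      go (≤′-step m≤n)       c = go m≤n (decreasing c)

    Constraints : Set
    Constraints = List (Site d × Fin q)

    _⊨_ : Config d q → Constraints → Set
    x ⊨ Γ = ∀ {z a} → (z , a) ∈ Γ → x z ≡ a

    -- Constraints that each of the sets C n can satisfy.
    Live : Constraints → Set
    Live Γ = ∀ n → ∃[ x ] (C n x × x ⊨ Γ)

    -- If each symbol at z were excluded by some C n, then all symbols would
    -- be excluded by the C N with N the largest of these n.
    live-∷ : ∀ {Γ} → Live Γ → ∀ z → ∃[ a ] Live ((z , a) ∷ Γ)
    live-∷ {Γ} live z with em {∃[ a ] Live ((z , a) ∷ Γ)}
    ... | yes ∃a = ∃a
    ... | no ∄a  = contradiction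
      ( x , decreasing-≤ (dead≤N (x z)) Cx
      , λ { (here refl) → refl ; (there za∈Γ) → x⊨Γ za∈Γ })
      (proj₂ (dead (x z)))
      where
      dead : ∀ a → ∃[ n ] ¬ (∃[ x ] (C n x × x ⊨ ((z , a) ∷ Γ)))
      dead a = ¬∀⇒∃¬ (λ alive → ∄a (a , alive))
      N = proj₁ (upper-bound (proj₁ ∘ dead))
      dead≤N = proj₂ (upper-bound (proj₁ ∘ dead))
      x = proj₁ (live N)
      Cx : C N x
      Cx = proj₁ (proj₂ (live N))
      x⊨Γ : x ⊨ Γ
      x⊨Γ = proj₂ (proj₂ (live N))

    Constrains : Constraints → Site d → Set
    Constrains Γ z = ∃[ a ] (z , a) ∈ Γ

    live-window : ∀ {k} (K : Vec (Site d) k) {Γ} → Live Γ →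
      ∃[ Γ′ ] (Live Γ′ × (∀ {za} → za ∈ Γ → za ∈ Γ′) × (∀ i → Constrains Γ′ (lookup K i)))
    live-window []      live = _ , live , id , λ ()
    live-window (z ∷ K) live =
      let a  , live-a           = live-∷ live z
          Γ′ , live′ , ⊆Γ′ , K′ = live-window K live-a
      in Γ′ , live′ , ⊆Γ′ ∘ there , λ { zero → a , ⊆Γ′ (here refl) ; (suc i) → K′ i }

    -- Live constraints at all sites of the boxes of radius less than n.
    stage : ℕ → ∃[ Γ ] Live Γ
    stage zero    = [] , λ n → proj₁ (inhabited n) , proj₂ (inhabited n) , λ ()
    stage (suc n) = let Γ , live , _ = live-window (sites (box d n)) (proj₂ (stage n)) in Γ , live

    stage-mono : ∀ {m n} → m ≤ n → ∀ {za} → za ∈ proj₁ (stage m) → za ∈ proj₁ (stage n)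
    stage-mono {m} m≤n = go (ℕ.≤⇒≤′ m≤n)
      where
      go : ∀ {n} → m ≤′ n → ∀ {za} → za ∈ proj₁ (stage m) → za ∈ proj₁ (stage n)
      go (≤′-reflexive refl) za∈ = za∈
      go (≤′-step {n} m≤n)   za∈ =
        proj₁ (proj₂ (proj₂ (live-window (sites (box d n)) (proj₂ (stage n))))) (go m≤n za∈)

    stage-constrains : ∀ z → Constrains (proj₁ (stage (suc (norm z)))) z
    stage-constrains z with i , eq ← norm≤⇒∈box z ℕ.≤-refl = subst (Constrains _) eq
      (proj₂ (proj₂ (proj₂ (live-window (sites (box d (norm z))) (proj₂ (stage (norm z)))))) i)

    -- The stages increase, so all constraints agree with the limit.
    limit : Config d q
    limit z = proj₁ (stage-constrains z)

    limit-∈ : ∀ n → C n limit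
    limit-∈ n with k , K , local-K ← local n = local-K (map-≡⁺ K agree) (proj₁ (proj₂ witness))
      where
      witness = proj₂ (stage (suc (radius K))) n
      agree : ∀ {z} → z ∈ᵛ K → proj₁ witness z ≡ limit z
      agree (i , refl) = proj₂ (proj₂ witness)
        (stage-mono (s≤s (norm≤radius K i)) (proj₂ (stage-constrains (lookup K i))))

  -- A decreasing sequence of local sets with empty intersection is
  -- eventually empty.
  eventually-empty : (C : ℕ → Pred (Config d q) 0ℓ) → (∀ n → Local (C n)) →
    (∀ {n x} → C (suc n) x → C n x) → (∀ x → ∃[ n ] ¬ C n x) → ∃[ n ] (∀ x → ¬ C n x)
  eventually-empty C local decreasing empty
    with n , ¬inhabited ← ¬∀⇒∃¬ {P = λ n → ∃[ x ] C n x} (λ inhabited →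
           let n , ¬C = empty (limit C local decreasing inhabited)
           in ¬C (limit-∈ C local decreasing inhabited n)) = n , λ x Cx → ¬inhabited (x , Cx)

-- Covers

-- A sequence that lists L 0, L 1, ... one after another, with gaps.
module Enumeration {A : Set} (L : ℕ → List A) where

  -- The remaining entries xs of the current list, then L n, L (n + 1), ...
  from : List A → ℕ → ℕ → Maybe A
  from (x ∷ xs) n zero    = just x
  from (x ∷ xs) n (suc k) = from xs n k
  from []       n zero    = nothing
  from []       n (suc k) = from (L n) (suc n) k

  enumerate : ℕ → Maybe A
  enumerate = from [] 0

  from-current : ∀ {x xs n} → x ∈ xs → ∃[ k ] from xs n k ≡ just x
  from-current (here refl) = 0 , refl
  from-current (there x∈)  = let k , eq = from-current x∈ in suc k , eq

  from-later : ∀ {x} xs n k → from [] n k ≡ just x → ∃[ j ] from xs n j ≡ just x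
  from-later []       n k eq = k , eq
  from-later (_ ∷ xs) n k eq = let j , eq′ = from-later xs n k eq in suc j , eq′

  from-list : ∀ j n {x} → x ∈ L (j + n) → ∃[ k ] from [] n k ≡ just x
  from-list zero    n x∈ = let k , eq = from-current x∈ in suc k , eq
  from-list (suc j) n {x} x∈ =
    let k , eq  = from-list j (suc n) (subst (λ i → x ∈ L i) (sym (ℕ.+-suc j n)) x∈)
        l , eq′ = from-later (L n) (suc n) k eq
    in suc l , eq′

  enumerate-∈ : ∀ {n x} → x ∈ L n → ∃[ k ] enumerate k ≡ just x
  enumerate-∈ {n} {x} x∈ = from-list n 0 (subst (λ i → x ∈ L i) (sym (ℕ.+-identityʳ n)) x∈)

module Weights {d q : ℕ} ⦃ _ : NonZero q ⦄ where

  opaque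
    -- The relative frequency of n among the patterns on k sites; opaque, so
    -- that it is not unfolded to a reduced fraction.
    frequency : ℕ → ℕ → ℚ
    frequency k n = ℚ._/_ (ℤ.+ n) (q ^ k) ⦃ ℕ.m^n≢0 q k ⦄

    frequency-mono : ∀ k {m n} → m ≤ n → frequency k m ℚ.≤ frequency k n
    frequency-mono k {m} {n} = /-mono {m} {n} (q ^ k) ⦃ ℕ.m^n≢0 q k ⦄

    frequency-+ : ∀ k m n → frequency k m ℚ.+ frequency k n ≡ frequency k (m + n)
    frequency-+ k m n = /-+ m n (q ^ k) ⦃ ℕ.m^n≢0 q k ⦄

    frequency-0 : ∀ k → frequency k 0 ≡ 0ℚ
    frequency-0 k = 0/-≡0 (q ^ k) ⦃ ℕ.m^n≢0 q k ⦄

    frequency-cross : ∀ k l m n → m * q ^ l ≡ n * q ^ k → frequency k m ≡ frequency l n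
    frequency-cross k l m n = /-cross {m} {q ^ k} {n} {q ^ l} ⦃ ℕ.m^n≢0 q k ⦄ ⦃ ℕ.m^n≢0 q l ⦄

    frequency-1-pos : ∀ k → 0ℚ ℚ.< frequency k 1
    frequency-1-pos k = ℚ.positive⁻¹ (frequency k 1) ⦃ ℚ.normalize-pos 1 (q ^ k) ⦃ ℕ.m^n≢0 q k ⦄ ⦄

    weight-frequency : ∀ (u : Cylinder d q) → weight (just u) ≡ frequency (Cylinder.size u) 1
    weight-frequency u = refl

  frequency-nonNeg : ∀ k n → 0ℚ ℚ.≤ frequency k n
  frequency-nonNeg k n = subst (ℚ._≤ frequency k n) (frequency-0 k) (frequency-mono k z≤n)

  -- The sum of the weights of a list of cylinders.
  total : List (Cylinder d q) → ℚ
  total []       = 0ℚ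
  total (u ∷ us) = weight (just u) ℚ.+ total us

  total-nonNeg : ∀ us → 0ℚ ℚ.≤ total us
  total-nonNeg []       = ℚ.≤-refl
  total-nonNeg (u ∷ us) = ℚ.+-mono-≤
    (subst (0ℚ ℚ.≤_) (sym (weight-frequency u)) (frequency-nonNeg (Cylinder.size u) 1))
    (total-nonNeg us)

  -- The cylinder of the configurations that read p on W.
  cylinderOn : (W : Window d) → Vec (Fin q) (size W) → Cylinder d q
  cylinderOn W p = record { sites = sites W ; distinct = distinct W ; symbols = p }

  total-frequency : ∀ {A : Set} k (g : A → Cylinder d q) (φ : A → ℕ) →
    (∀ a → weight (just (g a)) ≡ frequency k (φ a)) →
    ∀ as → total (List.map g as) ≡ frequency k (∑ as φ)
  total-frequency k g φ eq []       = sym (frequency-0 k)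
  total-frequency k g φ eq (a ∷ as) = trans
    (cong₂ ℚ._+_ (eq a) (total-frequency k g φ eq as)) (frequency-+ k (φ a) (∑ as φ))

  partialSum-suc : ∀ (U : Cover {d} {q}) k →
    partialSum U (suc k) ≡ weight (U 0) ℚ.+ partialSum (U ∘ suc) k
  partialSum-suc U zero    = ℚ.+-comm 0ℚ (weight (U 0))
  partialSum-suc U (suc k) = trans (cong (ℚ._+ weight (U (suc k))) (partialSum-suc U k))
    (ℚ.+-assoc (weight (U 0)) (partialSum (U ∘ suc) k) (weight (U (suc k))))

  module _ (L : ℕ → List (Cylinder d q)) where

    open Enumeration L

    -- The total weight of the first n lists.
    totals : ℕ → ℚ
    totals zero    = 0ℚ
    totals (suc n) = totals n ℚ.+ total (L n)

    -- The weights enumerated so far and those of the rest of the current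
    -- list add up to totals n throughout.
    partialSum-from : ∀ k xs n w → w ℚ.+ total xs ≡ totals n →
                      ∃[ m ] (w ℚ.+ partialSum (from xs n) k ℚ.≤ totals m)
    partialSum-from zero xs n w eq =
      n , subst (w ℚ.+ 0ℚ ℚ.≤_) eq (ℚ.+-monoʳ-≤ w (total-nonNeg xs))
    partialSum-from (suc k) (x ∷ xs) n w eq =
      let m , le = partialSum-from k xs n (w ℚ.+ weight (just x))
                     (trans (ℚ.+-assoc w (weight (just x)) (total xs)) eq)
      in m , subst (ℚ._≤ totals m)
               (trans (ℚ.+-assoc w (weight (just x)) (partialSum (from xs n) k))
                 (cong (w ℚ.+_) (sym (partialSum-suc (from (x ∷ xs) n) k)))) le
    partialSum-from (suc k) [] n w eq =
      let m , le = partialSum-from k (L n) (suc n) w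
                     (cong (ℚ._+ total (L n)) (trans (sym (ℚ.+-identityʳ w)) eq))
      in m , subst (ℚ._≤ totals m) (cong (w ℚ.+_) (sym (trans (partialSum-suc (from [] n) k)
               (ℚ.+-identityˡ (partialSum (from (L n) (suc n)) k))))) le

    partialSum-enumerate : ∀ k → ∃[ m ] (partialSum enumerate k ℚ.≤ totals m)
    partialSum-enumerate k =
      let m , le = partialSum-from k [] 0 0ℚ refl
      in m , subst (ℚ._≤ totals m) (ℚ.+-identityˡ (partialSum enumerate k)) le

-- Some of the first m cylinders of U contains x.
Hits : ∀ {d q} → Cover {d} {q} → ℕ → Config d q → Set
Hits U m x = ∃[ i ] (i < m × ∃[ u ] (U i ≡ just u × ⟦ u ⟧ᶜ x))

hits-mono : ∀ {d q} {U : Cover {d} {q}} {m n x} → m ≤ n → Hits U m x → Hits U n x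
hits-mono m≤n (i , i<m , hit) = i , ℕ.<-≤-trans i<m m≤n , hit

-- A common bound for the supports of the first m cylinders.
cover-radius : ∀ {d q} (U : Cover {d} {q}) m →
  ∃[ R ] (∀ {i u} → i < m → U i ≡ just u → radius (support u) ≤ R)
cover-radius U zero    = 0 , λ ()
cover-radius U (suc m) = extent (U m) ⊔ R , bound
  where
  extent : Maybe (Cylinder _ _) → ℕ
  extent nothing  = 0
  extent (just u) = radius (support u)
  R = proj₁ (cover-radius U m)
  bound : ∀ {i u} → i < suc m → U i ≡ just u → radius (support u) ≤ extent (U m) ⊔ R
  bound i<1+m Ui≡u with ℕ.m<1+n⇒m<n∨m≡n i<1+m
  ... | inj₁ i<m  = ℕ.≤-trans (proj₂ (cover-radius U m) i<m Ui≡u) (ℕ.m≤n⊔m (extent (U m)) R)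
  ... | inj₂ refl = ℕ.≤-trans (ℕ.≤-reflexive (cong extent (sym Ui≡u))) (ℕ.m≤m⊔n (extent (U m)) R)

hits-local : ∀ {d q} {U : Cover {d} {q}} {m r x y} → proj₁ (cover-radius U m) ≤ r →
  Vec.map x (sites (box d r)) ≡ Vec.map y (sites (box d r)) → Hits U m x → Hits U m y
hits-local {U = U} {m} R≤r eq (i , i<m , u , Ui≡u , x∈u) = i , i<m , u , Ui≡u , trans
  (sym (map-≡-⊆ (⊆-box (support u) (ℕ.≤-trans (proj₂ (cover-radius U m) i<m Ui≡u) R≤r)) eq)) x∈u

module CoverBounds (em : ExcludedMiddle 0ℓ) {d q : ℕ} ⦃ _ : NonZero q ⦄ (blank : Fin q) where

  open Counting em
  open Patterns em {d} blank
  open Compactness em {d} {q}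
  open Weights {d} {q}

  -- The weight of a cylinder is its relative frequency on any larger window.
  weight-patterns : ∀ {k} {K : Vec (Site d) k} → Vec.Unique K → (u : Cylinder d q) →
    support u ⊆ᵛ K → weight (just u) ≡ frequency k (patterns K ⟦ u ⟧ᶜ)
  weight-patterns {k} {K} K! u D⊆K = trans (weight-frequency u)
    (frequency-cross n k 1 (patterns K ⟦ u ⟧ᶜ) (begin
    1 * q ^ k                      ≡⟨ ℕ.*-identityˡ (q ^ k) ⟩
    q ^ k                          ≡⟨ patterns-cylinder K! (support-unique u) D⊆K (symbols u) ⟨
    q ^ n * patterns K ⟦ u ⟧ᶜ      ≡⟨ ℕ.*-comm (q ^ n) (patterns K ⟦ u ⟧ᶜ) ⟩
    patterns K ⟦ u ⟧ᶜ * q ^ n      ∎))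
    where
    open ≡-Reasoning
    n = Cylinder.size u

  hits-≤-partialSum : ∀ {k} {K : Vec (Site d) k} → Vec.Unique K → (U : Cover {d} {q}) → ∀ m →
    (∀ {i u} → i < m → U i ≡ just u → support u ⊆ᵛ K) →
    frequency k (patterns K (Hits U m)) ℚ.≤ partialSum U m
  hits-≤-partialSum {k} {K} K! U zero _ = ℚ.≤-reflexive
    (trans (cong (frequency k) (count-false (allVecs q k) λ { _ (_ , () , _) })) (frequency-0 k))
  hits-≤-partialSum {k} {K} K! U (suc m) U⊆K = begin
    frequency k (patterns K (Hits U (suc m)))
      ≤⟨ frequency-mono k (ℕ.≤-trans (count-mono (allVecs q k) split-hit) (count-⊎ (allVecs q k))) ⟩
    frequency k (patterns K (Hits U m) + patterns K Last)
      ≡⟨ frequency-+ k (patterns K (Hits U m)) (patterns K Last) ⟨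
    frequency k (patterns K (Hits U m)) ℚ.+ frequency k (patterns K Last)
      ≤⟨ ℚ.+-mono-≤ (hits-≤-partialSum K! U m (λ i<m → U⊆K (ℕ.m<n⇒m<1+n i<m)))
                      (last (U m) (U⊆K ℕ.≤-refl)) ⟩
    partialSum U (suc m) ∎
    where
    open ℚ.≤-Reasoning
    Last : Pred (Config d q) 0ℓ
    Last x = ∃[ u ] (U m ≡ just u × ⟦ u ⟧ᶜ x)
    split-hit : ∀ {p} → Hits U (suc m) (extend K p) → Hits U m (extend K p) ⊎ Last (extend K p)
    split-hit (i , i<1+m , hit) with ℕ.m<1+n⇒m<n∨m≡n i<1+m
    ... | inj₁ i<m  = inj₁ (i , i<m , hit)
    ... | inj₂ refl = inj₂ hit
    last : ∀ o → (∀ {u} → o ≡ just u → support u ⊆ᵛ K) →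
           frequency k (patterns K (λ x → ∃[ u ] (o ≡ just u × ⟦ u ⟧ᶜ x))) ℚ.≤ weight o
    last nothing  _   = ℚ.≤-reflexive
      (trans (cong (frequency k) (count-false (allVecs q k) λ { _ (_ , () , _) })) (frequency-0 k))
    last (just u) u⊆K = ℚ.≤-trans
      (frequency-mono k (count-mono (allVecs q k) λ { (_ , refl , x∈u) → x∈u }))
      (ℚ.≤-reflexive (sym (weight-patterns K! u (u⊆K refl))))

  -- By compactness finitely many members of U cover the cylinder.
  weight-≤-cover : ∀ (u : Cylinder d q) (U : Cover {d} {q}) {y} → U covers ⟦ u ⟧ᶜ →
    (∀ m → partialSum U m ℚ.≤ y) → weight (just u) ℚ.≤ y
  weight-≤-cover u U {y} covers bound = begin
    weight (just u)                          ≡⟨ weight-patterns K! u u⊆K ⟩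
    frequency k (patterns K ⟦ u ⟧ᶜ)          ≤⟨ frequency-mono k (count-mono (allVecs q k) (finite _)) ⟩
    frequency k (patterns K (Hits U n))      ≤⟨ hits-≤-partialSum K! U n U⊆K ⟩
    partialSum U n                           ≤⟨ bound n ⟩
    y                                        ∎
    where
    open ℚ.≤-Reasoning
    Missed : ℕ → Pred (Config d q) 0ℓ
    Missed n x = ⟦ u ⟧ᶜ x × ¬ Hits U n x
    R : ℕ → ℕ
    R n = radius (support u) ⊔ proj₁ (cover-radius U n)
    local : ∀ n → Local (Missed n)
    local n = _ , sites (box d (R n)) , λ eq (x∈u , missed) →
      trans (sym (map-≡-⊆ (⊆-box (support u) (ℕ.m≤m⊔n _ _)) eq)) x∈u ,
      λ hit → missed (hits-local (ℕ.m≤n⊔m (radius (support u)) _) (sym eq) hit)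
    empty : ∀ x → ∃[ n ] ¬ Missed n x
    empty x with em {⟦ u ⟧ᶜ x}
    ... | no x∉u  = 0 , λ (x∈u , _) → x∉u x∈u
    ... | yes x∈u = let i , hit = covers x∈u in suc i , λ (_ , missed) → missed (i , ℕ.≤-refl , hit)
    eventually : ∃[ n ] (∀ x → ¬ Missed n x)
    eventually = eventually-empty Missed local
      (λ { {n} (x∈u , missed) → x∈u , missed ∘ hits-mono (ℕ.n≤1+n n) }) empty
    n = proj₁ eventually
    K = sites (box d (R n))
    K! = distinct (box d (R n))
    k = size (box d (R n))
    u⊆K : support u ⊆ᵛ K
    u⊆K = ⊆-box (support u) (ℕ.m≤m⊔n _ _)
    U⊆K : ∀ {i v} → i < n → U i ≡ just v → support v ⊆ᵛ K
    U⊆K {v = v} i<n Ui≡v = ⊆-box (support v)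
      (ℕ.≤-trans (proj₂ (cover-radius U n) i<n Ui≡v) (ℕ.m≤n⊔m (radius (support u)) _))
    finite : ∀ x → ⟦ u ⟧ᶜ x → Hits U n x
    finite x x∈u = decidable-stable em (λ miss → proj₂ eventually x (x∈u , miss))

-- Surjectivity and the uniform measure

-- E is closed under pointwise equality.
Respects≗ : ∀ {d q} → Pred (Config d q) 0ℓ → Set
Respects≗ E = ∀ {x y} → x ≗ y → E x → E y

borel-respects : ∀ {d q} (E : Borel d q) → Respects≗ ⟦ E ⟧
borel-respects (cyl u)        x≗y x∈u       = trans (sym (Vec.map-cong x≗y (support u))) x∈u
borel-respects (complement E) x≗y x∉E       = x∉E ∘ borel-respects E (sym ∘ x≗y)
borel-respects (union E)      x≗y (i , x∈E) = i , borel-respects (E i) x≗y x∈E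

uniform-antitone : ∀ {d q} ⦃ _ : NonZero q ⦄ {E E′ : Pred (Config d q) 0ℓ} →
  (∀ {x} → E′ x → E x) → ∀ {b} → uniform d q E b → uniform d q E′ b
uniform-antitone E′⊆E (U , U-covers , bound) = U , (λ x∈E′ → U-covers (E′⊆E x∈E′)) , bound

least : ExcludedMiddle 0ℓ → ∀ {P : ℕ → Set} {n} → P n → ∃[ m ] (P m × (∀ k → k < m → ¬ P k))
least em {P} {n} p with search n
  where
  search : ∀ n → (∀ k → k < n → ¬ P k) ⊎ (∃[ m ] (P m × (∀ k → k < m → ¬ P k)))
  search zero    = inj₁ λ _ ()
  search (suc n) with search n | em {P n}
  ... | inj₂ found | _     = inj₂ found
  ... | inj₁ none  | yes p = inj₂ (n , p , none)
  ... | inj₁ none  | no ¬p = inj₁ λ k k<1+n → case-< k (ℕ.m<1+n⇒m<n∨m≡n k<1+n)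
    where
    case-< : ∀ k → k < n ⊎ k ≡ n → ¬ P k
    case-< k (inj₁ k<n)  = none k k<n
    case-< k (inj₂ refl) = ¬p
... | inj₁ none  = n , p , none
... | inj₂ found = found

module UniformMeasure (em : ExcludedMiddle 0ℓ) {d} (A : ClassicalCA (suc d))
  ⦃ _ : NonZero (ClassicalCA.#Q A) ⦄ (blank : Fin (ClassicalCA.#Q A)) where

  open ClassicalCA A using (V; global) renaming (#Q to q)
  open Counting em
  open Patterns em {suc d} blank
  open Compactness em {suc d} {q}
  open Weights {suc d} {q}
  open CoverBounds em {suc d} {q} blank

  S : ℕ → Window (suc d)
  S = box (suc d)

  -- The restriction of a configuration to the n-th box.
  word : ∀ n → Config (suc d) q → Vec (Fin q) (size (S n))
  word n x = Vec.map x (sites (S n))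

  -- All preimages of the word of e on S n lie in the first n cylinders of U.
  Good : Cover {suc d} {q} → ℕ → Pred (Config (suc d) q) 0ℓ
  Good U n e = ∀ x → word n (global x) ≡ word n e → Hits U n x

  good-local : ∀ {U n e e′} → word n e ≡ word n e′ → Good U n e → Good U n e′
  good-local eq good x eq′ = good x (trans eq′ (sym eq))

  -- The configurations outside the first n cylinders of U whose images read
  -- the word of e on S n form a decreasing sequence with empty intersection.
  eventually-good : ∀ U e → (∀ x → global x ≗ e → ∃[ i ] ∃[ u ] (U i ≡ just u × ⟦ u ⟧ᶜ x)) →
                    ∃[ n ] Good U n e
  eventually-good U e hit = proj₁ eventually , good
    where
    Missed : ℕ → Pred (Config (suc d) q) 0ℓ
    Missed n x = word n (global x) ≡ word n e × ¬ Hits U n x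
    r : ℕ → ℕ
    r n = (radius (sites (S n)) + radius V) ⊔ proj₁ (cover-radius U n)
    local : ∀ n → Local (Missed n)
    local n = _ , sites (S (r n)) , λ {x} {y} eq (Fx≡e , missed) →
      trans (sym (global-local A (neighbourhood⊆-box V (sites (S n)) (ℕ.m≤m⊔n _ _)) x y eq)) Fx≡e ,
      λ h → missed (hits-local (ℕ.m≤n⊔m (radius (sites (S n)) + radius V) _) (sym eq) h)
    empty : ∀ x → ∃[ n ] ¬ Missed n x
    empty x with em {global x ≗ e}
    ... | yes Fx≗e = let i , h = hit x Fx≗e in suc i , λ (_ , missed) → missed (i , ℕ.≤-refl , h)
    ... | no ¬Fx≗e = let z , Fx≢e = ¬∀⇒∃¬ ¬Fx≗e in
      norm z , λ (Fx≡e , _) → Fx≢e (map-≡⁻ (sites (S (norm z))) Fx≡e (norm≤⇒∈box z ℕ.≤-refl))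
    eventually : ∃[ n ] (∀ x → ¬ Missed n x)
    eventually = eventually-empty Missed local
      (λ { {n} (Fx≡e , missed) →
        map-≡-⊆ (box-mono (ℕ.n≤1+n n)) Fx≡e , missed ∘ hits-mono (ℕ.n≤1+n n) }) empty
    good : Good U (proj₁ eventually) e
    good x Fx≡e = decidable-stable em (λ miss → proj₂ eventually x (Fx≡e , miss))

  module _ (surj : Surjective A) where

    open Balanced em A surj blank using (patterns-preimage)

    -- The preimage of a cylinder as a finite union of cylinders of the same total weight.
    preimageCylinders : Maybe (Cylinder (suc d) q) → List (Cylinder (suc d) q)
    preimageCylinders nothing  = []
    preimageCylinders (just u) = List.map (cylinderOn W)
      (sieve (⟦ u ⟧ᶜ ∘ global ∘ extend (sites W)) (allVecs q (size W)))
      where W = S (radius (support u) + radius V)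

    total-preimageCylinders : ∀ o → total (preimageCylinders o) ≡ weight o
    total-preimageCylinders nothing  = refl
    total-preimageCylinders (just u) = begin
      total (List.map (cylinderOn W) ps)
        ≡⟨ total-frequency (size W) (cylinderOn W) (λ _ → 1) (weight-frequency ∘ cylinderOn W) ps ⟩
      frequency (size W) (∑ ps (λ _ → 1))
        ≡⟨ cong (frequency (size W)) (trans (∑-const ps 1) (trans (ℕ.*-identityʳ (List.length ps))
             (length-sieve (⟦ u ⟧ᶜ ∘ global ∘ extend (sites W)) (allVecs q (size W))))) ⟩
      frequency (size W) (patterns (sites W) (⟦ u ⟧ᶜ ∘ global))
        ≡⟨ cong (frequency (size W)) (patterns-preimage u ℕ.≤-refl) ⟩
      frequency (size W) (patterns (sites W) ⟦ u ⟧ᶜ)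
        ≡⟨ weight-patterns (distinct W) u (⊆-box (support u) (ℕ.m≤m+n _ _)) ⟨
      weight (just u) ∎
      where
      open ≡-Reasoning
      W = S (radius (support u) + radius V)
      ps = sieve (⟦ u ⟧ᶜ ∘ global ∘ extend (sites W)) (allVecs q (size W))

    preimageCylinders-cover : ∀ u {x} → ⟦ u ⟧ᶜ (global x) →
      ∃[ v ] (v ∈ preimageCylinders (just u) × ⟦ v ⟧ᶜ x)
    preimageCylinders-cover u {x} Fx∈u = cylinderOn W p , ∈ˡ.∈-map⁺ (cylinderOn W)
      (∈-sieve⁺ (∈-allVecs p) (trans
        (global-local A (neighbourhood⊆-box V (support u) ℕ.≤-refl) _ x (map-extend (distinct W) p))
        Fx∈u)) , refl
      where
      W = S (radius (support u) + radius V)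
      p = Vec.map x (sites W)

    uniform-preimage-≤ : ∀ {E b} → uniform (suc d) q E b → uniform (suc d) q (E ∘ global) b
    uniform-preimage-≤ {E} (U , U-covers , y , y<b , bound) =
      enumerate , enumerate-covers , y , y<b , λ k →
        let m , le = partialSum-enumerate L k
        in ℚ.≤-trans le (ℚ.≤-trans (ℚ.≤-reflexive (totals-L m)) (bound m))
      where
      L : ℕ → List (Cylinder (suc d) q)
      L i = preimageCylinders (U i)
      open Enumeration L
      totals-L : ∀ m → totals L m ≡ partialSum U m
      totals-L zero    = refl
      totals-L (suc m) = cong₂ ℚ._+_ (totals-L m) (total-preimageCylinders (U m))
      enumerate-covers : enumerate covers (E ∘ global)
      enumerate-covers {x} Fx∈E with i , u , Ui≡u , Fx∈u ← U-covers Fx∈E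
        with v , v∈ , x∈v ← preimageCylinders-cover u {x} Fx∈u =
        let k , eq = enumerate-∈ {i} (subst (λ o → v ∈ preimageCylinders o) (sym Ui≡u) v∈)
        in k , v , eq , x∈v

    -- The words that are good while their restrictions to smaller boxes are
    -- not give disjoint cylinders, with preimages inside the union of U.
    module _ (U : Cover {suc d} {q}) where

      -- The n-th box is the first one on which the word of e is good.
      First : ℕ → Pred (Config (suc d) q) 0ℓ
      First n e = Good U n e × (∀ m → m < n → ¬ Good U m e)

      first-local : ∀ {n e e′} → word n e ≡ word n e′ → First n e → First n e′
      first-local eq (good , minimal) = good-local eq good , λ m m<n good′ →
        minimal m m<n (good-local (sym (map-≡-⊆ (box-mono (ℕ.<⇒≤ m<n)) eq)) good′)

      firstWords : ∀ n → List (Vec (Fin q) (size (S n)))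
      firstWords n = sieve (First n ∘ extend (sites (S n))) (allVecs q (size (S n)))

      word∈firstWords : ∀ {n e} → First n e → word n e ∈ firstWords n
      word∈firstWords {n} {e} first = ∈-sieve⁺ (∈-allVecs (word n e))
        (first-local (sym (map-extend (distinct (S n)) (word n e))) first)

      word∈firstWords⁻ : ∀ {n e} → word n e ∈ firstWords n → First n e
      word∈firstWords⁻ {n} {e} e∈ = first-local (map-extend (distinct (S n)) (word n e))
        (proj₂ (∈-sieve⁻ {xs = allVecs q (size (S n))} e∈))

      firstCylinders : ℕ → List (Cylinder (suc d) q)
      firstCylinders n = List.map (cylinderOn (S n)) (firstWords n)

      -- By balance, the weight of a cylinder is the frequency of its preimage.
      total-firstCylinders : ∀ {n r} → n + radius V ≤ r → total (firstCylinders n) ℚ.≤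
        frequency (size (S r)) (patterns (sites (S r)) (First n ∘ global))
      total-firstCylinders {n} {r} n+V≤r = begin
        total (firstCylinders n)
          ≡⟨ total-frequency k (cylinderOn (S n)) N weight≡ (firstWords n) ⟩
        frequency k (∑ (firstWords n) N)
          ≡⟨ cong (frequency k) (∑-count-fibres (allVecs q k)
               (Unique.filter⁺ (λ _ → em) (allVecs-unique q (size (S n))))
               (word n ∘ global ∘ extend K)) ⟩
        frequency k (patterns K (λ x → word n (global x) ∈ firstWords n))
          ≤⟨ frequency-mono k (count-mono (allVecs q k) word∈firstWords⁻) ⟩
        frequency k (patterns K (First n ∘ global)) ∎
        where
        open ℚ.≤-Reasoning
        k = size (S r)
        K = sites (S r)
        N : Vec (Fin q) (size (S n)) → ℕ
        N w = patterns K (λ x → word n (global x) ≡ w)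
        S+V≤r : radius (sites (S n)) + radius V ≤ r
        S+V≤r = ℕ.≤-trans
          (ℕ.+-monoˡ-≤ (radius V) (radius-lub (sites (S n)) (norm-box (suc d) n))) n+V≤r
        weight≡ : ∀ w → weight (just (cylinderOn (S n) w)) ≡ frequency k (N w)
        weight≡ w = trans
          (weight-patterns (distinct (S r)) (cylinderOn (S n) w)
            (⊆-box (sites (S n)) (ℕ.m+n≤o⇒m≤o _ S+V≤r)))
          (cong (frequency k) (sym (patterns-preimage (cylinderOn (S n) w) S+V≤r)))

      -- Some box before the m-th is the first good one.
      FirstBelow : ℕ → Pred (Config (suc d) q) 0ℓ
      FirstBelow m e = ∃[ n ] (n < m × First n e)

      totals-firstCylinders : ∀ {r} m → m + radius V ≤ r → totals firstCylinders m ℚ.≤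
        frequency (size (S r)) (patterns (sites (S r)) (FirstBelow m ∘ global))
      totals-firstCylinders {r} zero    _     = frequency-nonNeg (size (S r)) _
      totals-firstCylinders {r} (suc m) m+V<r = begin
        totals firstCylinders m ℚ.+ total (firstCylinders m)
          ≤⟨ ℚ.+-mono-≤ (totals-firstCylinders m (ℕ.<⇒≤ m+V<r)) (total-firstCylinders (ℕ.<⇒≤ m+V<r)) ⟩
        frequency k (patterns K (FirstBelow m ∘ global)) ℚ.+ frequency k (patterns K (First m ∘ global))
          ≡⟨ frequency-+ k _ _ ⟩
        frequency k (patterns K (FirstBelow m ∘ global) + patterns K (First m ∘ global))
          ≤⟨ frequency-mono k (count-disjoint (allVecs q k)
               (λ (n , n<m , first) → n , ℕ.m<n⇒m<1+n n<m , first)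
               (λ first → m , ℕ.≤-refl , first)
               (λ (n , n<m , good , _) (_ , minimal) → minimal n n<m good)) ⟩
        frequency k (patterns K (FirstBelow (suc m) ∘ global)) ∎
        where
        open ℚ.≤-Reasoning
        k = size (S r)
        K = sites (S r)

      totals-≤-partialSum : ∀ m → totals firstCylinders m ℚ.≤ partialSum U m
      totals-≤-partialSum m = begin
        totals firstCylinders m
          ≤⟨ totals-firstCylinders m (ℕ.m≤m⊔n (m + radius V) _) ⟩
        frequency (size (S r)) (patterns (sites (S r)) (FirstBelow m ∘ global))
          ≤⟨ frequency-mono (size (S r)) (count-mono (allVecs q (size (S r)))
               (λ (n , n<m , good , _) → hits-mono (ℕ.<⇒≤ n<m) (good _ refl))) ⟩
        frequency (size (S r)) (patterns (sites (S r)) (Hits U m))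
          ≤⟨ hits-≤-partialSum (distinct (S r)) U m (λ {_} {u} i<m Ui≡u → ⊆-box (support u)
               (ℕ.≤-trans (proj₂ (cover-radius U m) i<m Ui≡u) (ℕ.m≤n⊔m (m + radius V) _))) ⟩
        partialSum U m ∎
        where
        open ℚ.≤-Reasoning
        r = (m + radius V) ⊔ proj₁ (cover-radius U m)

    uniform-preimage-≥ : ∀ {E b} → Respects≗ E →
      uniform (suc d) q (E ∘ global) b → uniform (suc d) q E b
    uniform-preimage-≥ {E} resp (U , U-covers , y , y<b , bound) =
      enumerate , enumerate-covers , y , y<b , λ k →
        let m , le = partialSum-enumerate (firstCylinders U) k
        in ℚ.≤-trans le (ℚ.≤-trans (totals-≤-partialSum U m) (bound m))
      where
      open Enumeration (firstCylinders U)
      enumerate-covers : enumerate covers E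
      enumerate-covers {e} e∈E =
        let n , first = least em {λ n → Good U n e}
              (proj₂ (eventually-good U e λ x Fx≗e → U-covers (resp (sym ∘ Fx≗e) e∈E)))
            k , eq = enumerate-∈ {n} (∈ˡ.∈-map⁺ (cylinderOn (S n)) (word∈firstWords U first))
        in k , cylinderOn (S n) (word n e) , eq , refl

  -- A configuration e without preimage would have, on some box, a word
  -- without preimage, whose cylinder has positive measure.
  measure-preserving⇒surjective :
    (∀ u {b} → uniform (suc d) q (⟦ u ⟧ᶜ ∘ global) b → uniform (suc d) q ⟦ u ⟧ᶜ b) →
    ∀ e → ∃[ x ] global x ≗ e
  measure-preserving⇒surjective preserving e with em {∃[ x ] global x ≗ e}
  ... | yes ∃x = ∃x
  ... | no ∄x  = ⊥-elim (ℚ.<-irrefl refl (ℚ.<-≤-trans y<w (weight-≤-cover u U U-covers bound)))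
    where
    -- Nothing hits the empty cover, so the words that are good for it are
    -- those without preimages.
    no-cover : Cover {suc d} {q}
    no-cover _ = nothing
    orphan : ∃[ n ] Good no-cover n e
    orphan = eventually-good no-cover e (λ x Fx≗e → contradiction (x , Fx≗e) ∄x)
    n = proj₁ orphan
    u = cylinderOn (S n) (word n e)
    partialSum-no-cover : ∀ m → partialSum no-cover m ≡ 0ℚ
    partialSum-no-cover zero    = refl
    partialSum-no-cover (suc m) = trans (ℚ.+-identityʳ _) (partialSum-no-cover m)
    small : uniform (suc d) q ⟦ u ⟧ᶜ (weight (just u))
    small = preserving u ( no-cover
                         , (λ {x} Fx∈u → let i , _ , hit = proj₂ orphan x Fx∈u in i , hit)
                         , 0ℚ , subst (0ℚ ℚ.<_) (sym (weight-frequency u)) (frequency-1-pos (size (S n)))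
                         , λ m → ℚ.≤-reflexive (partialSum-no-cover m) )
    U = proj₁ small
    U-covers : U covers ⟦ u ⟧ᶜ
    U-covers = proj₁ (proj₂ small)
    y<w = proj₁ (proj₂ (proj₂ (proj₂ small)))
    bound = proj₂ (proj₂ (proj₂ (proj₂ small)))

surjective⇔sameStochastic : ExcludedMiddle 0ℓ → ∀ {d} (A : ClassicalCA (suc d)) →
  Problem.Yes (surjectivity (suc d)) A ⇔ Problem.Yes (sameStochastic (suc d)) (reduction A)
surjective⇔sameStochastic em A@record { #Q = zero } = mk⇔
  (λ _ → refl , λ _ _ → (λ {_} h → h) , λ {_} h → h)
  (λ _ y → ⊥-elim (no-state (y origin)))
  where
  no-state : Fin 0 → ⊥
  no-state ()
surjective⇔sameStochastic em {d} A@record { #Q = suc _ } = mk⇔ preserves onto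
  where
  open ClassicalCA A using (global) renaming (#Q to q)
  open UniformMeasure em A zero
  open StochasticCA (pureNoise (suc d) q) using (explicit)
  noise : ∀ c s → explicit c s ≗ s
  noise c s z = cong s (⊹-origin z)
  preserves : Problem.Yes (surjectivity (suc d)) A →
              Problem.Yes (sameStochastic (suc d)) (reduction A)
  preserves surj = refl , λ c E →
    (λ {_} h → uniform-antitone (λ {s} → borel-respects E (noise c s))
                 (uniform-preimage-≥ surj (borel-respects E) h)) ,
    (λ {_} h → uniform-preimage-≤ surj {⟦ E ⟧}
                 (uniform-antitone (λ {s} → borel-respects E (sym ∘ noise c s)) h))
  onto : Problem.Yes (sameStochastic (suc d)) (reduction A) →
         Problem.Yes (surjectivity (suc d)) A
  onto (refl , same) e =
    let c = λ _ → zero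
        x , Fx≗e = measure-preserving⇒surjective (λ u h →
          uniform-antitone (λ {s} → borel-respects (cyl u) (sym ∘ noise c s))
            (proj₁ (same c (cyl u)) h)) e
    in x , λ z≗x i → trans (global-cong A z≗x i) (Fx≗e i)

theorem4p1 : (d : ℕ) → 1 ≤ d →
    (surjectivity d ≤ₘ sameNonDet d) ×
    (ExcludedMiddle 0ℓ → surjectivity d ≤ₘ sameStochastic d)
theorem4p1 d@(suc _) _ =
  (reduction , (reductionProgram d , reductionProgram-correct) , surjective⇔sameNonDet) ,
  λ em → reduction , (reductionProgram d , reductionProgram-correct) , surjective⇔sameStochastic em
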